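{- Let $G=(V,E)$ be a graph with ordered vertex set $\{v_1,\dots,v_n\}$ and vertex weights $w(v)$ for all $v\in V$. Let $k\in\mathbb{N}$ be the desired number of parts, $\varepsilon>0$ a balance parameter, and $A=\frac1k\sum_{v\in V}w(v)$. Then the algorithm Dynamic Partition (described in the context) runs in time $O(|V||E|k)$. Moreover, if $w(v)>0$ and $\deg(v)=O(1)$ for all $v\in V$, and $\max_v\{w(v)\}/\min_v\{w(v)\}=O(1)$, then Dynamic Partition runs in time $O(|V|^2)$. Further, Dynamic Partition returns a partition $\mathcal{P}$ of $V$ into $k$ parts, consistent with the ordering $(v_1,\dots,v_n)$, such that each part has total weight between $(1-\varepsilon)A$ and $(1+\varepsilon)A$, if such a partition exists. In that case $\mathcal{P}$ has the minimum number of cut edges over all such consistent partitions, and if $(v_1,\dots,v_n)$ is a Hamiltonian path of $G$, then each part of $\mathcal{P}$ is connected.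
   Context: A partition $\{V_1,\dots,V_k\}$ of the vertex set is consistent with the ordering $(v_1,\dots,v_n)$ if for all $1\le i<j\le k$ and all $u\in V_i$, $v\in V_j$, $u$ precedes $v$ in the ordering (so each part is an interval of the ordering). A cut edge of a partition is an edge with endpoints in different parts; $\delta(X,Y)$ is the number of edges with one endpoint in $X$ and the other in $Y$. A part is connected if the subgraph of $G$ it induces is connected. Running time counts elementary operations (arithmetic on weights has unit cost). In the $O(|V|^2)$ statement the balance parameter $\varepsilon$ is regarded as fixed and the implied constant may depend on it and on the constants in the $O(1)$ hypotheses. Algorithm Dynamic Partition. Let $G_s$ be the subgraph of $G$ induced by $\{v_1,\dots,v_s\}$. Maintain arrays $\mathrm{Parts}(s,t)$ and $\mathrm{Cut}(s,t)$, $0\le s\le n$, $0\le t\le k$, initialized with $\mathrm{Parts}(s,t)=\emptyset$, and $\mathrm{Cut}(s,t)=\infty$ except $\mathrm{Cut}(0,0)=0$. For $t$ from $1$ to $k$, and for $s$ from $t$ to $n-k+t$: (i) set $$r=\operatorname*{arg\,min}_{j\le s:\ |\sum_{i=j}^s w(v_i)-A|\le\varepsilon A}\ \mathrm{Cut}(j-1,t-1)+\delta(\{v_1,\dots,v_{j-1}\},\{v_j,\dots,v_s\});$$ (ii) set $\mathrm{Parts}(s,t)=\mathrm{Parts}(r-1,t-1)\cup\{\{v_i: r\le i\le s\}\}$; (iii) set $\mathrm{Cut}(s,t)$ to the number of cut edges of $\mathrm{Parts}(s,t)$ in $G_s$. If there is no admissible $j$ with finite value, $\mathrm{Cut}(s,t)$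 remains $\infty$. Return $\mathrm{Parts}(n,k)$. The cuts $\delta(\{v_1,\dots,v_{j-1}\},\{v_j,\dots,v_s\})$ and the sums $\sum_{i=j}^s w(v_i)$ are computed incrementally as $j$ decreases from $s$, and when all weights are positive the scan over $j$ stops as soon as the sum exceeds $(1+\varepsilon)A$.
   Formalization: O(|V||E|k) fails for graphs with few edges (e.g. edgeless), so it is proved when |V|=O(|E|), and for all graphs with max(|V|,|E|) in place of |E|; O(|V|²) is proved for k≤|V|, since array initialization alone exceeds it for huge k; V is nonempty in the time bounds. -}

module Defs where

open import Level using (Level; 0ℓ; suc; _⊔_)
open import Algebra.Bundles using (CommutativeRing)
import Algebra.Definitions.RawMonoid as RawMonoid
open import Data.Bool.Base using (Bool; true; false; if_then_else_; _∧_)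
open import Data.Fin.Base using (Fin; toℕ)
import Data.Fin.Base as Fin
import Data.Fin.Properties as Fin
open import Data.Fin.Subset using (Subset; Nonempty; _∈_; _∉_)
open import Data.Fin.Subset.Properties using (_∈?_)
open import Data.List.Base
  using (List; []; _∷_; length; lookup; map; filter; allFin; take; reverse;
         cartesianProduct; tabulate)
import Data.List.Extrema as Extrema
open import Data.Maybe.Base using (Maybe; just; nothing)
import Data.Maybe.Base as Maybe
open import Data.Nat.Base as ℕ using (ℕ; NonZero; pred)
import Data.Nat.Properties as ℕ
open import Data.Product.Base using (_×_; _,_; ∃-syntax; proj₁)
open import Data.Unit.Base using (⊤; tt)
import Data.Vec.Base as Vec
open import Data.Vec.Functional using (Vector)
open import Function.Base using (_∘_)
open import Relation.Binary.Bundles using (DecTotalOrder)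
open import Relation.Binary.Core using (Rel)
open import Relation.Binary.Construct.Add.Supremum.NonStrict ℕ._≤_ using (_≤⁺_)
import Relation.Binary.Construct.NonStrictToStrict as NonStrictToStrict
open import Relation.Binary.Construct.Closure.ReflexiveTransitive using (Star)
open import Relation.Binary.Definitions using (Decidable; Irreflexive; Symmetric)
open import Relation.Binary.PropositionalEquality.Core using (_≡_; _≢_)
open import Relation.Binary.Structures using (IsDecTotalOrder)
open import Relation.Nullary.Construct.Add.Supremum using (_⁺; ⊤⁺; [_])
open import Relation.Nullary.Decidable.Core using (Dec; yes; no; does; _×-dec_; _⊎-dec_; ¬?)
open import Relation.Nullary.Negation.Core using (¬_)

------------------------------------------------------------------------
-- The field of weights

-- Weights, the balance parameter and the constants bounding ratios of
-- weights live in an arbitrary Archimedean ordered field whose order is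
-- decidable: ℚ is one, and classically so are ℝ and all its subfields.
-- The value of _⁻¹ at zero is unconstrained.

record ArchimedeanOrderedField c ℓ₁ ℓ₂ : Set (suc (c ⊔ ℓ₁ ⊔ ℓ₂)) where
  infix  4 _≤_ _<?_
  infix  8 _⁻¹
  field
    commutativeRing : CommutativeRing c ℓ₁
  open CommutativeRing commutativeRing public
  field
    _≤_             : Rel Carrier ℓ₂
    isDecTotalOrder : IsDecTotalOrder _≈_ _≤_
    +-monoˡ-≤       : ∀ z {x y} → x ≤ y → x + z ≤ y + z
    *-nonneg        : ∀ {x y} → 0# ≤ x → 0# ≤ y → 0# ≤ x * y
    0≉1             : ¬ 0# ≈ 1#
    _⁻¹             : Carrier → Carrier
    ⁻¹-inverseʳ     : ∀ x → ¬ x ≈ 0# → x * x ⁻¹ ≈ 1#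
    archimedean     : ∀ x → ∃[ m ] x ≤ RawMonoid._×_ +-rawMonoid m 1#

  open RawMonoid +-rawMonoid public using (sum) renaming (_×_ to _·_)

  decTotalOrder : DecTotalOrder c ℓ₁ ℓ₂
  decTotalOrder = record { isDecTotalOrder = isDecTotalOrder }

  open DecTotalOrder decTotalOrder public using (_≟_; _≤?_; totalOrder)
  open import Relation.Binary.Properties.DecTotalOrder decTotalOrder public
    using (_<_)
  open import Algebra.Construct.NaturalChoice.Max totalOrder public
    using () renaming (_⊔_ to _max_)

  _<?_ : Decidable _<_
  _<?_ = NonStrictToStrict.<-decidable _≈_ _≤_ _≟_ _≤?_

  ∣_∣ : Carrier → Carrier
  ∣ x ∣ = x max (- x)

------------------------------------------------------------------------
-- Graphs

-- A finite simple graph on the ordered vertex set {v₁,…,vₙ}.  The vertex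
-- vᵢ is the element of Fin n whose toℕ is i - 1.

record Graph (n : ℕ) : Set₁ where
  infix 4 _~_ _~?_
  field
    _~_    : Rel (Fin n) 0ℓ
    _~?_   : Decidable _~_
    sym    : Symmetric _~_
    irrefl : Irreflexive _≡_ _~_

  neighbours : Fin n → List (Fin n)
  neighbours u = filter (u ~?_) (allFin n)

  degree : Fin n → ℕ
  degree u = length (neighbours u)

  -- Each edge is listed once, with its earlier endpoint first.
  edges : List (Fin n × Fin n)
  edges = filter (λ (u , v) → (u Fin.<? v) ×-dec (u ~? v))
                 (cartesianProduct (allFin n) (allFin n))

  ∣E∣ : ℕ
  ∣E∣ = length edges

  edgesWithin : Subset n → List (Fin n × Fin n)
  edgesWithin X = filter (λ (u , v) → (u ∈? X) ×-dec (v ∈? X)) edges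

  δ : Subset n → Subset n → ℕ
  δ X Y = length (filter (λ (u , v) → ((u ∈? X) ×-dec (v ∈? Y)) ⊎-dec
                                      ((u ∈? Y) ×-dec (v ∈? X))) edges)

  Induced : Subset n → Rel (Fin n) 0ℓ
  Induced X u v = u ∈ X × v ∈ X × u ~ v

  Connected : Subset n → Set
  Connected X = ∀ {u v} → u ∈ X → v ∈ X → Star (Induced X) u v

  -- (v₁,…,vₙ) lists every vertex exactly once, so only the adjacency of
  -- consecutive vertices remains to be asked.
  OrderingIsHamiltonianPath : Set
  OrderingIsHamiltonianPath = ∀ u v → toℕ v ≡ ℕ.suc (toℕ u) → u ~ v

open Graph using (edges; ∣E∣)

------------------------------------------------------------------------
-- Partitions

-- {V₁,…,Vₖ} is the list V₁ ∷ … ∷ Vₖ ∷ [].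

module _ {n : ℕ} where

  record IsPartition (P : List (Subset n)) : Set where
    field
      nonempty : ∀ i → Nonempty (lookup P i)
      disjoint : ∀ {i j} → i ≢ j → ∀ {v} → v ∈ lookup P i → v ∉ lookup P j
      covers   : ∀ v → ∃[ i ] v ∈ lookup P i

  Consistent : List (Subset n) → Set
  Consistent P = ∀ {i j} → i Fin.< j →
                 ∀ {u v} → u ∈ lookup P i → v ∈ lookup P j → u Fin.< v

  InDifferentParts : List (Subset n) → Fin n × Fin n → Set
  InDifferentParts P (u , v) = ∃[ i ] ∃[ j ] i ≢ j × u ∈ lookup P i × v ∈ lookup P j

  inDifferentParts? : ∀ P e → Dec (InDifferentParts P e)
  inDifferentParts? P (u , v) = Fin.any? λ i → Fin.any? λ j →
    ¬? (i Fin.≟ j) ×-dec (u ∈? lookup P i) ×-dec (v ∈? lookup P j)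

  cutEdges : List (Fin n × Fin n) → List (Subset n) → ℕ
  cutEdges E P = length (filter (inDifferentParts? P) E)

  -- {vᵢ : r ≤ i ≤ s}
  ⟦_⟧ : ℕ × ℕ → Subset n
  ⟦ r , s ⟧ = Vec.tabulate λ v →
    does (r ℕ.≤? ℕ.suc (toℕ v)) ∧ does (ℕ.suc (toℕ v) ℕ.≤? s)

------------------------------------------------------------------------
-- Weights

module Weights {c ℓ₁ ℓ₂} (F : ArchimedeanOrderedField c ℓ₁ ℓ₂) where
  open ArchimedeanOrderedField F

  module _ {n : ℕ} (w : Vector Carrier n) where

    weight : Subset n → Carrier
    weight X = sum λ v → if Vec.lookup X v then w v else 0#

    average : ℕ → Carrier
    average k = (k · 1#) ⁻¹ * sum w

    Balanced : ℕ → Carrier → Subset n → Set ℓ₂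
    Balanced k ε X = (1# - ε) * average k ≤ weight X ×
                     weight X ≤ (1# + ε) * average k

    record IsBalancedConsistentPartition
             (k : ℕ) (ε : Carrier) (P : List (Subset n)) : Set ℓ₂ where
      field
        isPartition : IsPartition P
        size        : length P ≡ k
        consistent  : Consistent P
        balanced    : ∀ i → Balanced k ε (lookup P i)

  maxWeight minWeight : ∀ {n} .{{_ : NonZero n}} → Vector Carrier n → Carrier
  maxWeight {ℕ.suc _} w = Extrema.max totalOrder (w Fin.zero) (tabulate w)
  minWeight {ℕ.suc _} w = Extrema.min totalOrder (w Fin.zero) (tabulate w)

------------------------------------------------------------------------
-- Counting elementary operations

record Timed {a} (A : Set a) : Set a where
  constructor _after_
  field
    value : A
    steps : ℕ

open Timed public

private
  variable
    a b : Level
    A B S : Set a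

infixl 1 _>>=_ _>>_

return : A → Timed A
return x = x after 0

_>>=_ : Timed A → (A → Timed B) → Timed B
m >>= f = value (f (value m)) after (steps m ℕ.+ steps (f (value m)))

_>>_ : Timed A → Timed B → Timed B
m >> m′ = m >>= λ _ → m′

-- A single elementary operation: arithmetic or a comparison on weights or
-- on integers, one access to the input, or one link added to a list.
op : A → Timed A
op x = x after 1

tick : Timed ⊤
tick = op tt

-- Two-dimensional arrays, with unit-cost access to an entry.
Array : Set a → Set a
Array A = ℕ → ℕ → A

-- Entries outside the allocated range are never read by the program below.
allocate : ℕ → ℕ → A → Timed (Array A)
allocate rows columns x = (λ _ _ → x) after (rows ℕ.* columns)

read : Array A → ℕ → ℕ → Timed A
read arr i j = op (arr i j)

write : Array A → ℕ → ℕ → A → Timed (Array A)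
write arr i j x = op λ i′ j′ →
  if does (i′ ℕ.≟ i) ∧ does (j′ ℕ.≟ j) then x else arr i′ j′

-- for lo hi body runs body at lo, lo + 1, …, hi.
for : ℕ → ℕ → (ℕ → S → Timed S) → S → Timed S
for {S = S} lo hi body = go lo (ℕ.suc hi ℕ.∸ lo)
  where
  go : ℕ → ℕ → S → Timed S
  go i ℕ.zero    x = tick >> return x
  go i (ℕ.suc m) x = do
    tick
    x ← body i x
    go (ℕ.suc i) m x

reverseList : List A → Timed (List A)
reverseList xs = reverse xs after ℕ.suc (length xs)

------------------------------------------------------------------------
-- The algorithm

-- A block {vᵢ : r ≤ i ≤ s} is stored as the pair (r , s).  A collection of
-- blocks is a linked list with the last block at its head, so that adjoining
-- a block to an already stored collection is a single operation.

record Tables : Set where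
  constructor tables
  field
    parts : Array (List (ℕ × ℕ))
    cut   : Array (ℕ ⁺)

module DynamicPartition
  {c ℓ₁ ℓ₂} (F : ArchimedeanOrderedField c ℓ₁ ℓ₂)
  {n : ℕ} (G : Graph n)
  (w : Vector (ArchimedeanOrderedField.Carrier F) n)
  (k : ℕ) (ε : ArchimedeanOrderedField.Carrier F)
  where

  open ArchimedeanOrderedField F
  open Graph G using (neighbours; edgesWithin; δ)
  open Weights F

  -- vₛ, vₛ₋₁, …, v₁
  verticesDownFrom : ℕ → List (Fin n)
  verticesDownFrom s = reverse (take s (allFin n))

  totalWeight : List (Fin n) → Timed Carrier
  totalWeight []       = tick >> return 0#
  totalWeight (v ∷ vs) = do
    W ← totalWeight vs
    x ← op (w v)
    op (x + W)

  allPositive : List (Fin n) → Timed Bool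
  allPositive []       = tick >> return true
  allPositive (v ∷ vs) = do
    x ← op (w v)
    p ← op (does (0# <? x))
    q ← allPositive vs
    op (p ∧ q)

  -- Turns d = δ({v₁,…,vⱼ},{vⱼ₊₁,…,vₛ}) into δ({v₁,…,vⱼ₋₁},{vⱼ,…,vₛ}), where
  -- v = vⱼ: its neighbours before v add an edge, those in {vⱼ₊₁,…,vₛ}
  -- remove one.
  updateδ : ℕ → Fin n → List (Fin n) → ℕ → Timed ℕ
  updateδ s v []       d = tick >> return d
  updateδ s v (u ∷ us) d = do
    tick
    before ← op (does (u Fin.<? v))
    if before
      then (do
        d ← op (ℕ.suc d)
        updateδ s v us d)
      else (do
        inside ← op (does (ℕ.suc (toℕ u) ℕ.≤? s))
        if inside
          then (do
            d ← op (pred d)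
            updateδ s v us d)
          else updateδ s v us d)

  -- The smallest finite value met so far, with the j at which it was met.
  Best : Set
  Best = Maybe (ℕ × ℕ)

  consider : ℕ → ℕ ⁺ → Best → Timed Best
  consider j ⊤⁺    best             = tick >> return best
  consider j [ x ] nothing          = op (just (x , j))
  consider j [ x ] (just (y , r)) = do
    less ← op (does (x ℕ.<? y))
    return (if less then just (x , j) else just (y , r))

  module _ (A εA upper : Carrier) (positive : Bool) where

    -- On the vertices vⱼ, …, v₁, σ is the weight of {vⱼ₊₁,…,vₛ} and d is
    -- δ({v₁,…,vⱼ},{vⱼ₊₁,…,vₛ}).
    scan : ℕ → ℕ → Array (ℕ ⁺) → List (Fin n) → Carrier → ℕ → Best → Timed Best
    scan s t cut []       σ d best = tick >> return best
    scan s t cut (v ∷ vs) σ d best = do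
      tick
      x ← op (w v)
      σ ← op (x + σ)
      exceeds ← op (does (upper <? σ))
      if positive ∧ exceeds
        then return best
        else (do
          d ← updateδ s v (neighbours v) d
          difference ← op (σ - A)
          deviation ← op ∣ difference ∣
          admissible ← op (does (deviation ≤? εA))
          if admissible
            then (do
              previous ← read cut (toℕ v) (pred t)
              candidate ← op (Maybe.map (ℕ._+ d) previous)
              best ← consider (ℕ.suc (toℕ v)) candidate best
              scan s t cut vs σ d best)
            else scan s t cut vs σ d best)

    update : ℕ → ℕ → Tables → Best → Timed Tables
    update s t T                   nothing        = tick >> return T
    update s t (tables parts cut) (just (x , r)) = do
      previous ← read parts (pred r) (pred t)
      blocks ← op ((r , s) ∷ previous)
      parts ← write parts s t blocks
      cut ← write cut s t [ x ]
      return (tables parts cut)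

    entry : ℕ → ℕ → Tables → Timed Tables
    entry t s T = do
      best ← scan s t (Tables.cut T) (verticesDownFrom s) 0# 0 nothing
      update s t T best

  -- (n + t) ∸ k is n - k + t, except that it is 0 < t when n + t < k; the
  -- inner loop is then empty, as it should be.
  fillTables : Timed Tables
  fillTables = do
    W ← totalWeight (allFin n)
    inverse ← op ((k · 1#) ⁻¹)
    A ← op (inverse * W)
    εA ← op (ε * A)
    factor ← op (1# + ε)
    upper ← op (factor * A)
    positive ← allPositive (allFin n)
    parts ← allocate (ℕ.suc n) (ℕ.suc k) []
    cut ← allocate (ℕ.suc n) (ℕ.suc k) ⊤⁺
    cut ← write cut 0 0 [ 0 ]
    for 1 k (λ t → for t ((n ℕ.+ t) ℕ.∸ k) (entry A εA upper positive t))
      (tables parts cut)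

  dynamicPartition : Timed (List (ℕ × ℕ))
  dynamicPartition = do
    T ← fillTables
    blocks ← read (Tables.parts T) n k
    reverseList blocks

  runningTime : ℕ
  runningTime = steps dynamicPartition

  output : List (Subset n)
  output = map ⟦_⟧ (value dynamicPartition)

  ----------------------------------------------------------------------
  -- The recurrence that the tables are meant to satisfy

  InLoopRange : ℕ → ℕ → Set
  InLoopRange s t = 1 ℕ.≤ t × t ℕ.≤ k × t ℕ.≤ s × s ℕ.+ k ℕ.≤ n ℕ.+ t

  module _ (T : Tables) where
    open Tables T

    Admissible : ℕ → ℕ → Set ℓ₂
    Admissible s j = 1 ℕ.≤ j × j ℕ.≤ s ×
                     ∣ weight w ⟦ j , s ⟧ - average w k ∣ ≤ ε * average w k

    objective : ℕ → ℕ → ℕ → ℕ ⁺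
    objective s t j = Maybe.map (ℕ._+ δ ⟦ 1 , pred j ⟧ ⟦ j , s ⟧)
                                (cut (pred j) (pred t))

    IsArgmin : ℕ → ℕ → ℕ → Set ℓ₂
    IsArgmin s t r = Admissible s r ×
                     (∀ j → Admissible s j → objective s t r ≤⁺ objective s t j)

    data IsEntry (s t : ℕ) : Set ℓ₂ where
      infinite : (∀ j → Admissible s j → objective s t j ≡ ⊤⁺) →
                 parts s t ≡ [] → cut s t ≡ ⊤⁺ → IsEntry s t
      finite   : ∀ r → IsArgmin s t r → objective s t r ≢ ⊤⁺ →
                 parts s t ≡ (r , s) ∷ parts (pred r) (pred t) →
                 cut s t ≡ [ cutEdges (edgesWithin ⟦ 1 , s ⟧) (map ⟦_⟧ (parts s t)) ] →
                 IsEntry s t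

    -- Steps (i), (ii) and (iii) of the algorithm read literally, with any
    -- choice among several minimisers; the program only stores the minimum
    -- itself in step (iii).
    record SatisfiesRecurrence : Set ℓ₂ where
      field
        cut-0-0   : cut 0 0 ≡ [ 0 ]
        parts-0-0 : parts 0 0 ≡ []
        initial   : ∀ s t → ¬ InLoopRange s t → (s , t) ≢ (0 , 0) →
                    parts s t ≡ [] × cut s t ≡ ⊤⁺
        entries   : ∀ s t → InLoopRange s t → IsEntry s t

{-# OPTIONS --safe #-}

-- Correctness.  A balanced consistent partition is a sequence of intervals
-- {vᵣ,…,vₛ}, each of weight within εA of A; the edges it cuts inside
-- {v₁,…,vₛ} are those its earlier intervals cut inside {v₁,…,vᵣ₋₁} together
-- with those counted by δ({v₁,…,vᵣ₋₁},{vᵣ,…,vₛ}).  Hence optimal solutions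
-- have optimal prefixes, and the recurrence computes the minimum.  The scan
-- over j maintains the weight, δ and the minimum so far; an early stop is
-- harmless because with positive weights no smaller j is admissible.
--
-- Running time.  One scan costs O(|V| + Σ deg) = O(|V| + |E|), and there are
-- at most k(|V| + 1) of them.  If all weights are at least μ > 0 and at most
-- Cμ, a scan stops within q + 1 vertices whenever (1+ε)A < qμ; since
-- kA ≤ |V|Cμ, q = O(1 + |V|/k) will do, and for k ≤ |V| the k(|V| + 1) scans of
-- O(|V|/k) vertices of bounded degree cost O(|V|²).

module Submission where

open import Defs

import Algebra.Construct.NaturalChoice.Max as Max
import Algebra.Properties.Monoid.Sum as MonoidSum
import Algebra.Properties.Ring as RingProperties
import Algebra.Properties.Semiring.Mult as SemiringMult
open import Data.Bool.Base using (Bool; true; false; if_then_else_; _∧_)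
open import Data.Empty using (⊥)
open import Data.Fin.Base as Fin using (Fin; toℕ)
import Data.Fin.Properties as Fin
open import Data.Fin.Subset using (Subset; Nonempty; _∈_; _∉_; _⊆_)
open import Data.Fin.Subset.Properties using (_∈?_; ⊆-antisym)
open import Data.List.Base
  using (List; []; _∷_; _++_; length; lookup; map; filter; take; reverse;
         reverseAcc; tabulate; allFin; cartesianProduct)
import Data.List.Extrema as Extrema
import Data.List.Membership.Propositional as List
import Data.List.Membership.Propositional.Properties as List
import Data.List.Properties as List
open import Data.List.Relation.Binary.Permutation.Propositional.Properties
  using (↭-reverse; map⁺)
import Data.List.Relation.Unary.All as All
import Data.List.Relation.Unary.All.Properties as All
import Data.List.Relation.Unary.Any as Any
import Data.List.Relation.Unary.Any.Properties as Any
open import Data.Maybe.Base using (just; nothing)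
import Data.Maybe.Base as Maybe
import Data.Maybe.Properties as Maybe
open import Data.Nat.Base as ℕ using (ℕ; NonZero; pred)
import Data.Nat.DivMod as ℕ
import Data.Nat.ListAction as ListAction
import Data.Nat.ListAction.Properties as ListAction
import Data.Nat.Properties as ℕ
open import Algebra.Properties.CommutativeMonoid.Sum ℕ.+-0-commutativeMonoid
  using (sum-cong-≗; sum-syntax; ∑-comm)
  renaming (sum to ∑; sum-replicate-zero to ∑-replicate-zero)
open import Data.Nat.Tactic.RingSolver using (solve-∀)
open import Data.Product.Base using (_×_; _,_; proj₁; proj₂; ∃-syntax)
open import Data.Sum.Base as Sum using (_⊎_; inj₁; inj₂)
import Data.Vec.Base as Vec
open import Data.Vec.Functional using (Vector)
import Data.Vec.Properties as Vec
open import Function.Base using (_∘_)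
open import Level using (Level)
open import Relation.Binary.Bundles using (DecTotalOrder)
open import Relation.Binary.Construct.Add.Supremum.NonStrict ℕ._≤_
  using (_≤⁺_; [_]; _≤⊤⁺; [≤]-injective; ≤⁺-trans; ≤⁺-reflexive-≡)
open import Relation.Binary.Construct.Closure.ReflexiveTransitive as Star
  using (Star; _◅_)
open import Relation.Binary.Definitions using (tri<; tri≈; tri>)
import Relation.Binary.Properties.DecTotalOrder as DecTotalOrderProperties
open import Relation.Binary.PropositionalEquality as ≡
  using (_≡_; _≢_; refl; cong; cong₂; subst)
import Relation.Binary.Reasoning.PartialOrder as PartialOrderReasoning
open import Relation.Nullary.Construct.Add.Supremum using (_⁺; ⊤⁺; [_])
open import Relation.Nullary.Decidable.Core
  using (Dec; yes; no; does; _×-dec_; _⊎-dec_; ¬?)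
open import Relation.Nullary.Decidable using (dec-true)
open import Relation.Nullary.Negation.Core using (¬_; contradiction)
open import Relation.Unary using (Pred; Decidable)

-- The program keeps in `cut` the minimum that the scan found, while step (iii) recounts the cut
-- edges of the stored parts. The recurrence is therefore proved along with soundness: every finite
-- entry holds a genuine sequence of intervals, and its number is their number of cut edges.
-- Soundness also bounds the length of the list reversed at the end, so the running time rests on
-- correctness. The incremental update of δ decrements with truncated `pred`. For this, δ, defined
-- on edges with the earlier endpoint first, is replaced by a count of ordered adjacent pairs, which
-- is symmetric and additive. A competing partition is a list of arbitrary subsets in increasing
-- order, while the tables hold endpoints with the last block first. Both the passage from
-- consistency to endpoints and the invariance of cut edges under reversal have to be shown. A scan
-- also pays for isolated vertices, hence the bound with max(|V|,|E|); the bound with |E| follows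
-- from it when |V| = O(|E|).

private
  variable
    a p q ℓ : Level
    A B S : Set a
    P : Pred A p
    Q : Pred A q
    R : Pred A ℓ
    n r s : ℕ

-- Arithmetic and order in the field of weights

module OrderedFieldProperties {c ℓ₁ ℓ₂} (F : ArchimedeanOrderedField c ℓ₁ ℓ₂) where
  open ArchimedeanOrderedField F hiding (refl)
  open DecTotalOrder decTotalOrder public
    using (poset)
    renaming (reflexive to ≤-reflexive; refl to ≤-refl; trans to ≤-trans;
              antisym to ≤-antisym; total to ≤-total)
  open DecTotalOrderProperties decTotalOrder public using (<⇒≱; ≮⇒≥)
  open Max totalOrder public using (⊔-cong; x≤x⊔y; x≤y⊔x; ⊔-lub)
  open RingProperties ring using (-‿involutive; -‿distribˡ-*; -‿distribʳ-*; -‿+-comm)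
  open SemiringMult semiring using (×1-homo-*)
  open PartialOrderReasoning poset

  private
    variable
      x y z x′ y′ : Carrier

  x-y+y≈x : ∀ x y → x - y + y ≈ x
  x-y+y≈x x y = begin-equality
    x - y + y       ≈⟨ +-assoc x (- y) y ⟩
    x + (- y + y)   ≈⟨ +-congˡ (-‿inverseˡ y) ⟩
    x + 0#          ≈⟨ +-identityʳ x ⟩
    x               ∎

  +-monoʳ-≤ : ∀ z → x ≤ y → z + x ≤ z + y
  +-monoʳ-≤ {x} {y} z x≤y = begin
    z + x ≈⟨ +-comm z x ⟩
    x + z ≤⟨ +-monoˡ-≤ z x≤y ⟩
    y + z ≈⟨ +-comm y z ⟩
    z + y ∎

  +-mono-≤ : x ≤ y → x′ ≤ y′ → x + x′ ≤ y + y′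
  +-mono-≤ x≤y x′≤y′ = ≤-trans (+-monoˡ-≤ _ x≤y) (+-monoʳ-≤ _ x′≤y′)

  x-y≤z⇒x≤z+y : x - y ≤ z → x ≤ z + y
  x-y≤z⇒x≤z+y {x} {y} {z} p = begin
    x         ≈⟨ x-y+y≈x x y ⟨
    x - y + y ≤⟨ +-monoˡ-≤ y p ⟩
    z + y     ∎

  x≤z+y⇒x-y≤z : x ≤ z + y → x - y ≤ z
  x≤z+y⇒x-y≤z {x} {z} {y} p = begin
    x - y         ≤⟨ +-monoˡ-≤ (- y) p ⟩
    z + y - y     ≈⟨ +-assoc z y (- y) ⟩
    z + (y - y)   ≈⟨ +-congˡ (-‿inverseʳ y) ⟩
    z + 0#        ≈⟨ +-identityʳ z ⟩
    z             ∎

  x≤y⇒0≤y-x : x ≤ y → 0# ≤ y - x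
  x≤y⇒0≤y-x {x} {y} x≤y = begin
    0#    ≈⟨ -‿inverseʳ x ⟨
    x - x ≤⟨ +-monoˡ-≤ (- x) x≤y ⟩
    y - x ∎

  *-monoˡ-≤ : 0# ≤ z → x ≤ y → z * x ≤ z * y
  *-monoˡ-≤ {z} {x} {y} 0≤z x≤y = begin
    z * x                     ≈⟨ +-identityˡ (z * x) ⟨
    0# + z * x                ≤⟨ +-monoˡ-≤ (z * x) (*-nonneg 0≤z (x≤y⇒0≤y-x x≤y)) ⟩
    z * (y - x) + z * x       ≈⟨ distribˡ z (y - x) x ⟨
    z * (y - x + x)           ≈⟨ *-congˡ (x-y+y≈x y x) ⟩
    z * y                     ∎

  *-monoʳ-≤ : 0# ≤ z → x ≤ y → x * z ≤ y * z
  *-monoʳ-≤ {z} {x} {y} 0≤z x≤y = begin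
    x * z ≈⟨ *-comm x z ⟩
    z * x ≤⟨ *-monoˡ-≤ 0≤z x≤y ⟩
    z * y ≈⟨ *-comm z y ⟩
    y * z ∎

  -1*-1≈1 : - 1# * - 1# ≈ 1#
  -1*-1≈1 = begin-equality
    - 1# * - 1#   ≈⟨ -‿distribʳ-* (- 1#) 1# ⟨
    - (- 1# * 1#) ≈⟨ -‿cong (*-identityʳ (- 1#)) ⟩
    - - 1#        ≈⟨ -‿involutive 1# ⟩
    1#            ∎

  -- If 1 ≤ 0 then -1 is nonnegative, and so is its square, which is 1.
  0≤1 : 0# ≤ 1#
  0≤1 with ≤-total 0# 1#
  ... | inj₁ 0≤1 = 0≤1
  ... | inj₂ 1≤0 = begin
    0#          ≤⟨ *-nonneg 0≤-1 0≤-1 ⟩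
    - 1# * - 1# ≈⟨ -1*-1≈1 ⟩
    1#          ∎
    where
    0≤-1 : 0# ≤ - 1#
    0≤-1 = begin
      0#      ≤⟨ x≤y⇒0≤y-x 1≤0 ⟩
      0# - 1# ≈⟨ +-identityˡ (- 1#) ⟩
      - 1#    ∎

  ∣x-y∣≤z⁻ : ∣ x - y ∣ ≤ z → y - z ≤ x × x ≤ y + z
  ∣x-y∣≤z⁻ {x} {y} {z} p = x≤z+y⇒x-y≤z lower , upper
    where
    lower : y ≤ x + z
    lower = begin
      y               ≈⟨ x-y+y≈x y x ⟨
      y - x + x       ≈⟨ +-congʳ (+-congʳ (-‿involutive y)) ⟨
      - - y - x + x   ≈⟨ +-congʳ (-‿+-comm (- y) x) ⟩
      - (- y + x) + x ≈⟨ +-congʳ (-‿cong (+-comm (- y) x)) ⟩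
      - (x - y) + x   ≤⟨ +-monoˡ-≤ x (≤-trans (x≤y⊔x _ _) p) ⟩
      z + x           ≈⟨ +-comm z x ⟩
      x + z           ∎
    upper : x ≤ y + z
    upper = begin
      x     ≤⟨ x-y≤z⇒x≤z+y (≤-trans (x≤x⊔y _ _) p) ⟩
      z + y ≈⟨ +-comm z y ⟩
      y + z ∎

  ∣x-y∣≤z⁺ : y - z ≤ x → x ≤ y + z → ∣ x - y ∣ ≤ z
  ∣x-y∣≤z⁺ {y} {z} {x} lower upper = ⊔-lub (x≤z+y⇒x-y≤z upper′) lower′
    where
    upper′ : x ≤ z + y
    upper′ = ≤-trans upper (≤-reflexive (+-comm y z))
    lower′ : - (x - y) ≤ z
    lower′ = begin
      - (x - y)   ≈⟨ -‿+-comm x (- y) ⟨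
      - x - - y   ≈⟨ +-congˡ (-‿involutive y) ⟩
      - x + y     ≈⟨ +-comm (- x) y ⟩
      y - x       ≤⟨ x≤z+y⇒x-y≤z (≤-trans (x-y≤z⇒x≤z+y lower) (≤-reflexive (+-comm x z))) ⟩
      z           ∎

  ∣∣-cong : x ≈ y → ∣ x ∣ ≈ ∣ y ∣
  ∣∣-cong x≈y = ⊔-cong x≈y (-‿cong x≈y)

  [1-x]*y≈y-x*y : ∀ x y → (1# - x) * y ≈ y - x * y
  [1-x]*y≈y-x*y x y = begin-equality
    (1# - x) * y       ≈⟨ distribʳ y 1# (- x) ⟩
    1# * y + - x * y   ≈⟨ +-cong (*-identityˡ y) (sym (-‿distribˡ-* x y)) ⟩
    y - x * y          ∎

  [1+x]*y≈y+x*y : ∀ x y → (1# + x) * y ≈ y + x * y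
  [1+x]*y≈y+x*y x y = begin-equality
    (1# + x) * y       ≈⟨ distribʳ y 1# x ⟩
    1# * y + x * y     ≈⟨ +-congʳ (*-identityˡ y) ⟩
    y + x * y          ∎

  ι : ℕ → Carrier
  ι m = m · 1#

  ι-homo-* : ∀ m n → ι (m ℕ.* n) ≈ ι m * ι n
  ι-homo-* = ×1-homo-*

  ι-suc-* : ∀ m x → ι (ℕ.suc m) * x ≈ x + ι m * x
  ι-suc-* m = [1+x]*y≈y+x*y (ι m)

  0≤ι : ∀ m → 0# ≤ ι m
  0≤ι ℕ.zero    = ≤-refl
  0≤ι (ℕ.suc m) = begin
    0#      ≈⟨ +-identityˡ 0# ⟨
    0# + 0# ≤⟨ +-mono-≤ 0≤1 (0≤ι m) ⟩
    1# + ι m ∎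

  ι≉0 : ∀ m .{{_ : NonZero m}} → ¬ ι m ≈ 0#
  ι≉0 (ℕ.suc m) eq = 0≉1 (≤-antisym 0≤1 (begin
    1#        ≈⟨ +-identityʳ 1# ⟨
    1# + 0#   ≤⟨ +-monoʳ-≤ 1# (0≤ι m) ⟩
    1# + ι m  ≈⟨ eq ⟩
    0#        ∎))

  ι-mono-≤ : ∀ {m n} → m ℕ.≤ n → ι m ≤ ι n
  ι-mono-≤ {n = n} ℕ.z≤n = 0≤ι n
  ι-mono-≤ (ℕ.s≤s m≤n) = +-monoʳ-≤ 1# (ι-mono-≤ m≤n)

  -- By contraposition: n < m gives (n + 1)x ≤ mx ≤ nx, hence x ≤ 0. This brings an inequality
  -- between weights back to natural numbers.
  ι-*-cancelʳ-≤ : ∀ {m n} → 0# < x → ι m * x ≤ ι n * x → m ℕ.≤ n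
  ι-*-cancelʳ-≤ {x} {m} {n} 0<x p with ℕ.≤-<-connex m n
  ... | inj₁ m≤n = m≤n
  ... | inj₂ n<m = contradiction x≤0 (<⇒≱ 0<x)
    where
    1+n≤n : x + ι n * x ≤ 0# + ι n * x
    1+n≤n = begin
      x + ι n * x      ≈⟨ ι-suc-* n x ⟨
      ι (ℕ.suc n) * x  ≤⟨ *-monoʳ-≤ (proj₁ 0<x) (ι-mono-≤ {ℕ.suc n} {m} n<m) ⟩
      ι m * x          ≤⟨ p ⟩
      ι n * x          ≈⟨ +-identityˡ _ ⟨
      0# + ι n * x     ∎
    x≤0 : x ≤ 0#
    x≤0 = begin
      x                         ≈⟨ +-identityʳ x ⟨
      x + 0#                    ≈⟨ +-congˡ (-‿inverseʳ _) ⟨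
      x + (ι n * x - ι n * x)   ≈⟨ +-assoc _ _ _ ⟨
      x + ι n * x - ι n * x     ≤⟨ x≤z+y⇒x-y≤z 1+n≤n ⟩
      0#                        ∎

  sum-≤ : ∀ {n} (w : Vector Carrier n) → (∀ i → w i ≤ x) → sum w ≤ ι n * x
  sum-≤ {x} {ℕ.zero}  w w≤ = ≤-reflexive (sym (zeroˡ x))
  sum-≤ {x} {ℕ.suc n} w w≤ = begin
    sum w                    ≤⟨ +-mono-≤ (w≤ Fin.zero) (sum-≤ (λ i → w (Fin.suc i)) (λ i → w≤ (Fin.suc i))) ⟩
    x + ι n * x              ≈⟨ ι-suc-* n x ⟨
    ι (ℕ.suc n) * x          ∎

  0≤1+x : 0# < x → 0# ≤ 1# + x
  0≤1+x {x} 0<x = begin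
    0#        ≤⟨ 0≤1 ⟩
    1#        ≈⟨ +-identityʳ 1# ⟨
    1# + 0#   ≤⟨ +-monoʳ-≤ 1# (proj₁ 0<x) ⟩
    1# + x    ∎

  x*y⁻¹≤z⇒x≤z*y : 0# < y → x * y ⁻¹ ≤ z → x ≤ z * y
  x*y⁻¹≤z⇒x≤z*y {y} {x} {z} 0<y p = begin
    x               ≈⟨ *-identityʳ x ⟨
    x * 1#          ≈⟨ *-congˡ (⁻¹-inverseʳ y (λ eq → proj₂ 0<y (sym eq))) ⟨
    x * (y * y ⁻¹)  ≈⟨ *-congˡ (*-comm y (y ⁻¹)) ⟩
    x * (y ⁻¹ * y)  ≈⟨ *-assoc x _ _ ⟨
    x * y ⁻¹ * y    ≤⟨ *-monoʳ-≤ (proj₁ 0<y) p ⟩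
    z * y           ∎

  -- With y the total weight, `ι k ⁻¹ * y` is the average A; the lemma clears its denominator.
  ι*[x*[ι⁻¹*y]]≈x*y : ∀ k .{{_ : NonZero k}} x y → ι k * (x * (ι k ⁻¹ * y)) ≈ x * y
  ι*[x*[ι⁻¹*y]]≈x*y k x y = begin-equality
    ι k * (x * (ι k ⁻¹ * y)) ≈⟨ *-assoc _ _ _ ⟨
    ι k * x * (ι k ⁻¹ * y)   ≈⟨ *-congʳ (*-comm _ _) ⟩
    x * ι k * (ι k ⁻¹ * y)   ≈⟨ *-assoc _ _ _ ⟩
    x * (ι k * (ι k ⁻¹ * y)) ≈⟨ *-congˡ (*-assoc _ _ _) ⟨
    x * (ι k * ι k ⁻¹ * y)   ≈⟨ *-congˡ (*-congʳ (⁻¹-inverseʳ (ι k) (ι≉0 k))) ⟩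
    x * (1# * y)             ≈⟨ *-congˡ (*-identityˡ y) ⟩
    x * y                    ∎

-- Counting in lists and over pairs of vertices

count : {P : Pred A p} → Decidable P → List A → ℕ
count P? xs = length (filter P? xs)

count-cong : (P? : Decidable P) (Q? : Decidable Q) →
             (∀ {x} → P x → Q x) → (∀ {x} → Q x → P x) →
             ∀ xs → count P? xs ≡ count Q? xs
count-cong P? Q? P⊆Q Q⊆P xs = cong length (List.filter-≐ P? Q? (P⊆Q , Q⊆P) xs)

-- The four conditions say that P is the disjoint union of Q and R. Every splitting of edges below
-- is an instance: δ when one side loses a vertex, cut edges when a block is adjoined, adjacent
-- pairs by orientation.
count-⊎ : (P? : Decidable P) (Q? : Decidable Q) (R? : Decidable R) →
          (∀ {x} → P x → Q x ⊎ R x) → (∀ {x} → Q x → P x) → (∀ {x} → R x → P x) →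
          (∀ {x} → Q x → R x → ⊥) →
          ∀ xs → count P? xs ≡ count Q? xs ℕ.+ count R? xs
count-⊎ P? Q? R? P⇒ Q⇒ R⇒ disjoint [] = refl
count-⊎ P? Q? R? P⇒ Q⇒ R⇒ disjoint (x ∷ xs)
  with ih ← count-⊎ P? Q? R? P⇒ Q⇒ R⇒ disjoint xs | P? x | Q? x | R? x
... | yes _  | yes _  | no  _  = cong ℕ.suc ih
... | yes _  | no  _  | yes _  = ≡.trans (cong ℕ.suc ih) (≡.sym (ℕ.+-suc _ _))
... | no  _  | no  _  | no  _  = ih
... | _      | yes Qx | yes Rx = contradiction Rx (disjoint Qx)
... | no ¬Px | yes Qx | _      = contradiction (Q⇒ Qx) ¬Px
... | no ¬Px | _      | yes Rx = contradiction (R⇒ Rx) ¬Px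
... | yes Px | no ¬Qx | no ¬Rx with P⇒ Px
...   | inj₁ Qx = contradiction Qx ¬Qx
...   | inj₂ Rx = contradiction Rx ¬Rx

count-filter : (P? : Decidable P) (Q? : Decidable Q) →
               ∀ xs → count P? (filter Q? xs) ≡ count (λ x → Q? x ×-dec P? x) xs
count-filter P? Q? [] = refl
count-filter P? Q? (x ∷ xs) with ih ← count-filter P? Q? xs | Q? x
... | no  _ = ih
... | yes _ with P? x
...   | no  _ = ih
...   | yes _ = cong ℕ.suc ih

𝟙 : Dec B → ℕ
𝟙 P? = if does P? then 1 else 0

𝟙-no : (P? : Dec B) → ¬ B → 𝟙 P? ≡ 0
𝟙-no (yes p) ¬p = contradiction p ¬p
𝟙-no (no _)  ¬p = refl

𝟙-cong : (P? : Dec A) (Q? : Dec B) → (A → B) → (B → A) → 𝟙 P? ≡ 𝟙 Q?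
𝟙-cong (yes _) (yes _) f g = refl
𝟙-cong (no _)  (no _)  f g = refl
𝟙-cong (yes a) (no ¬b) f g = contradiction (f a) ¬b
𝟙-cong (no ¬a) (yes b) f g = contradiction (g b) ¬a

count-tabulate : (P? : Decidable P) → ∀ {n} (f : Fin n → A) →
                 count P? (tabulate f) ≡ ∑[ i < n ] 𝟙 (P? (f i))
count-tabulate P? {ℕ.zero}  f = refl
count-tabulate P? {ℕ.suc n} f
  with ih ← count-tabulate P? (f ∘ Fin.suc) | P? (f Fin.zero)
... | yes _ = cong ℕ.suc ih
... | no  _ = ih

count-cartesianProduct :
  {P : Pred (A × B) p} (P? : Decidable P) → ∀ {m n} (f : Fin m → A) (g : Fin n → B) →
  count P? (cartesianProduct (tabulate f) (tabulate g)) ≡ ∑[ i < m ] ∑[ j < n ] 𝟙 (P? (f i , g j))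
count-cartesianProduct P? {ℕ.zero}  f g = refl
count-cartesianProduct P? {ℕ.suc m} {n} f g = begin
  count P? (map (f Fin.zero ,_) (tabulate g) ++ rest)
    ≡⟨ cong length (List.filter-++ P? (map (f Fin.zero ,_) (tabulate g)) rest) ⟩
  length (filter P? (map (f Fin.zero ,_) (tabulate g)) ++ filter P? rest)
    ≡⟨ List.length-++ (filter P? (map (f Fin.zero ,_) (tabulate g))) ⟩
  count P? (map (f Fin.zero ,_) (tabulate g)) ℕ.+ count P? rest
    ≡⟨ cong₂ ℕ._+_ (≡.trans (cong (count P?) (List.map-tabulate g (f Fin.zero ,_)))
                        (count-tabulate P? (λ j → f Fin.zero , g j)))
                 (count-cartesianProduct P? (f ∘ Fin.suc) g) ⟩
  _ ∎
  where
  open ≡.≡-Reasoning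
  rest = cartesianProduct (tabulate (f ∘ Fin.suc)) (tabulate g)

∑-zero : ∀ {n} (f : Fin n → ℕ) → (∀ i → f i ≡ 0) → ∑ f ≡ 0
∑-zero {n} f f≡0 = ≡.trans (sum-cong-≗ f≡0) (∑-replicate-zero n)

∑-single : ∀ {n} (f : Fin n → ℕ) i → (∀ j → j ≢ i → f j ≡ 0) → ∑ f ≡ f i
∑-single f Fin.zero    f≡0 =
  ≡.trans (cong (f Fin.zero ℕ.+_) (∑-zero (f ∘ Fin.suc) λ j → f≡0 (Fin.suc j) λ ())) (ℕ.+-identityʳ _)
∑-single f (Fin.suc i) f≡0 =
  cong₂ ℕ._+_ (f≡0 Fin.zero λ ()) (∑-single (f ∘ Fin.suc) i λ j j≢i → f≡0 (Fin.suc j) (j≢i ∘ Fin.suc-injective))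

pairs : ∀ n → List (Fin n × Fin n)
pairs n = cartesianProduct (allFin n) (allFin n)

module _ {n : ℕ} where

  count-pairs : {P : Pred (Fin n × Fin n) p} (P? : Decidable P) →
                count P? (pairs n) ≡ ∑[ u < n ] ∑[ v < n ] 𝟙 (P? (u , v))
  count-pairs P? = count-cartesianProduct P? (λ u → u) (λ v → v)

  -- As a double sum of indicators, the count is unchanged when the two summations are exchanged.
  count-swap : {P : Pred (Fin n × Fin n) p} (P? : Decidable P) →
               count P? (pairs n) ≡ count (λ (u , v) → P? (v , u)) (pairs n)
  count-swap P? = begin
    count P? (pairs n)                           ≡⟨ count-pairs P? ⟩
    ∑[ u < n ] ∑[ v < n ] 𝟙 (P? (u , v))     ≡⟨ ∑-comm (λ u v → 𝟙 (P? (u , v))) ⟩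
    ∑[ v < n ] ∑[ u < n ] 𝟙 (P? (u , v))     ≡⟨ count-pairs (λ (u , v) → P? (v , u)) ⟨
    count (λ (u , v) → P? (v , u)) (pairs n)     ∎
    where open ≡.≡-Reasoning

  -- P forces the first coordinate to be i, so all other rows of the double sum vanish. This links
  -- counts over pairs to lists of neighbours.
  count-row : {P : Pred (Fin n × Fin n) p} (P? : Decidable P)
              {Q : Pred (Fin n) q} (Q? : Decidable Q) (i : Fin n) →
              (∀ {u v} → P (u , v) → u ≡ i × Q v) → (∀ {v} → Q v → P (i , v)) →
              count P? (pairs n) ≡ count Q? (allFin n)
  count-row P? Q? i P⇒ Q⇒ = begin
    count P? (pairs n)                           ≡⟨ count-pairs P? ⟩
    ∑[ u < n ] ∑[ v < n ] 𝟙 (P? (u , v))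
      ≡⟨ ∑-single _ i (λ u u≢i → ∑-zero _ λ v → 𝟙-no (P? (u , v)) (u≢i ∘ proj₁ ∘ P⇒)) ⟩
    ∑[ v < n ] 𝟙 (P? (i , v))                ≡⟨ sum-cong-≗ (λ v → 𝟙-cong (P? (i , v)) (Q? v) (proj₂ ∘ P⇒) Q⇒) ⟩
    ∑[ v < n ] 𝟙 (Q? v)                      ≡⟨ count-tabulate Q? (λ v → v) ⟨
    count Q? (allFin n)                      ∎
    where open ≡.≡-Reasoning

-- Membership in intervals, and the change of δ when a vertex crosses the cut

∧-true : (P? : Dec A) (Q? : Dec B) → does P? ∧ does Q? ≡ true → A × B
∧-true (yes a) (yes b) refl = a , b

∈⟦⟧⁺ : ∀ {r s} {v : Fin n} → r ℕ.≤ ℕ.suc (toℕ v) → ℕ.suc (toℕ v) ℕ.≤ s → v ∈ ⟦ r , s ⟧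
∈⟦⟧⁺ {r = r} {s} {v} r≤v v≤s = Vec.lookup⇒[]= v _
  (≡.trans (Vec.lookup∘tabulate _ v) (cong₂ _∧_ (dec-true (r ℕ.≤? _) r≤v) (dec-true (_ ℕ.≤? s) v≤s)))

∈⟦⟧⁻ : ∀ r s {v : Fin n} → v ∈ ⟦ r , s ⟧ → r ℕ.≤ ℕ.suc (toℕ v) × ℕ.suc (toℕ v) ℕ.≤ s
∈⟦⟧⁻ r s {v} v∈ =
  ∧-true (r ℕ.≤? _) (_ ℕ.≤? s) (≡.trans (≡.sym (Vec.lookup∘tabulate _ v)) (Vec.[]=⇒lookup v∈))

module GraphProperties {n : ℕ} (G : Graph n) where
  open Graph G renaming (sym to ~-sym)

  -- Counts ordered adjacent pairs rather than edges listed by their earlier endpoint, which makes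
  -- it symmetric in P and Q and additive in each.
  arcs : {P : Pred (Fin n) p} {Q : Pred (Fin n) q} → Decidable P → Decidable Q → ℕ
  arcs P? Q? = count (λ (u , v) → P? u ×-dec Q? v ×-dec (u ~? v)) (pairs n)

  arcs-⊎ʳ : ∀ {q₁ q₂} {P : Pred (Fin n) p} {Q : Pred (Fin n) q} {Q₁ : Pred (Fin n) q₁} {Q₂ : Pred (Fin n) q₂}
            (P? : Decidable P) (Q? : Decidable Q) (Q₁? : Decidable Q₁) (Q₂? : Decidable Q₂) →
            (∀ {v} → Q v → Q₁ v ⊎ Q₂ v) → (∀ {v} → Q₁ v → Q v) → (∀ {v} → Q₂ v → Q v) →
            (∀ {v} → Q₁ v → Q₂ v → ⊥) →
            arcs P? Q? ≡ arcs P? Q₁? ℕ.+ arcs P? Q₂?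
  arcs-⊎ʳ P? Q? Q₁? Q₂? split Q₁⇒ Q₂⇒ disjoint = count-⊎ _ _ _
    (λ (p , q , e) → Sum.map (λ q₁ → p , q₁ , e) (λ q₂ → p , q₂ , e) (split q))
    (λ (p , q , e) → p , Q₁⇒ q , e) (λ (p , q , e) → p , Q₂⇒ q , e)
    (λ (_ , q₁ , _) (_ , q₂ , _) → disjoint q₁ q₂) (pairs n)

  arcs-comm : {P : Pred (Fin n) p} {Q : Pred (Fin n) q} (P? : Decidable P) (Q? : Decidable Q) →
              arcs P? Q? ≡ arcs Q? P?
  arcs-comm P? Q? = ≡.trans (count-swap {n = n} _)
    (count-cong _ _ (λ (p , q , e) → q , p , ~-sym e) (λ (q , p , e) → p , q , ~-sym e) (pairs n))

  arcs-neighbours : {Q : Pred (Fin n) q} (v : Fin n) (Q? : Decidable Q) →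
                    arcs (Fin._≟ v) Q? ≡ count Q? (neighbours v)
  arcs-neighbours v Q? = ≡.trans
    (count-row _ (λ u → (v ~? u) ×-dec Q? u) v
      (λ { (refl , q , e) → refl , e , q }) (λ (e , q) → refl , q , e))
    (≡.sym (count-filter Q? (v ~?_) (allFin n)))

  -- As X precedes Y, an edge between them has its earlier endpoint in X: the second alternative in
  -- δ never occurs and the orientation u < v is automatic.
  δ≡arcs : ∀ X Y → (∀ {u v} → u ∈ X → v ∈ Y → u Fin.< v) →
           δ X Y ≡ arcs (_∈? X) (_∈? Y)
  δ≡arcs X Y X<Y = ≡.trans (count-filter _ _ (pairs n)) (count-cong _ _
    (λ { ((u<v , e) , inj₁ (u∈X , v∈Y)) → u∈X , v∈Y , e
       ; ((u<v , e) , inj₂ (u∈Y , v∈X)) → contradiction (X<Y v∈X u∈Y) (ℕ.<⇒≯ u<v) })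
    (λ (u∈X , v∈Y , e) → (X<Y u∈X v∈Y , e) , inj₁ (u∈X , v∈Y)) (pairs n))

  before? : (v : Fin n) → Decidable (λ (u : Fin n) → u Fin.< v)
  before? v u = u Fin.<? v

  -- The two tests of `updateδ` in the order in which the program makes them. The vertex v itself
  -- may pass, but it is not its own neighbour.
  inside? : (s : ℕ) (v : Fin n) → Decidable (λ (u : Fin n) → ¬ (u Fin.< v) × toℕ u ℕ.< s)
  inside? s v u = ¬? (u Fin.<? v) ×-dec (ℕ.suc (toℕ u) ℕ.≤? s)

  -- The common part m counts the edges from the vertices before v to those after v up to `s`. Each
  -- cut adds to m the edges at v that lead to the side not containing v. Two equations over one m
  -- avoid subtraction.
  δ-step : ∀ {s} (v : Fin n) → toℕ v ℕ.< s → ∃[ m ]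
           δ ⟦ 1 , toℕ v ⟧ ⟦ ℕ.suc (toℕ v) , s ⟧ ≡ m ℕ.+ count (before? v) (neighbours v) ×
           δ ⟦ 1 , ℕ.suc (toℕ v) ⟧ ⟦ ℕ.suc (ℕ.suc (toℕ v)) , s ⟧ ≡ m ℕ.+ count (inside? s v) (neighbours v)
  δ-step {s} v v<s = arcs (_∈? X′) (_∈? Y) , (begin
      δ X′ Y′                                          ≡⟨ δ≡arcs X′ Y′ separated ⟩
      arcs (_∈? X′) (_∈? Y′)
        ≡⟨ arcs-⊎ʳ (_∈? X′) (_∈? Y′) (_∈? Y) (Fin._≟ v) splitY Y⇒ v⇒ notY ⟩
      arcs (_∈? X′) (_∈? Y) ℕ.+ arcs (_∈? X′) (Fin._≟ v) ≡⟨ cong (arcs (_∈? X′) (_∈? Y) ℕ.+_) before≡ ⟩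
      arcs (_∈? X′) (_∈? Y) ℕ.+ before                   ∎) , (begin
      δ X Y                                            ≡⟨ δ≡arcs X Y separated′ ⟩
      arcs (_∈? X) (_∈? Y)                             ≡⟨ arcs-comm (_∈? X) (_∈? Y) ⟩
      arcs (_∈? Y) (_∈? X)
        ≡⟨ arcs-⊎ʳ (_∈? Y) (_∈? X) (_∈? X′) (Fin._≟ v) splitX X′⇒ v⇒′ notX ⟩
      arcs (_∈? Y) (_∈? X′) ℕ.+ arcs (_∈? Y) (Fin._≟ v)  ≡⟨ cong₂ ℕ._+_ (arcs-comm (_∈? X′) (_∈? Y)) inside≡ ⟨
      arcs (_∈? X′) (_∈? Y) ℕ.+ inside                   ∎)
    where
    open ≡.≡-Reasoning
    X  = ⟦ 1 , ℕ.suc (toℕ v) ⟧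
    X′ = ⟦ 1 , toℕ v ⟧
    Y  = ⟦ ℕ.suc (ℕ.suc (toℕ v)) , s ⟧
    Y′ = ⟦ ℕ.suc (toℕ v) , s ⟧
    inside = count (inside? s v) (neighbours v)
    before = count (before? v) (neighbours v)

    separated : ∀ {a b} → a ∈ X′ → b ∈ Y′ → a Fin.< b
    separated a∈ b∈ = ℕ.≤-trans (proj₂ (∈⟦⟧⁻ 1 (toℕ v) a∈)) (ℕ.s≤s⁻¹ (proj₁ (∈⟦⟧⁻ (ℕ.suc (toℕ v)) s b∈)))

    separated′ : ∀ {a b} → a ∈ X → b ∈ Y → a Fin.< b
    separated′ a∈ b∈ = ℕ.s≤s⁻¹ (ℕ.≤-trans (ℕ.s≤s (proj₂ (∈⟦⟧⁻ 1 (ℕ.suc (toℕ v)) a∈))) (proj₁ (∈⟦⟧⁻ (ℕ.suc (ℕ.suc (toℕ v))) s b∈)))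

    splitY : ∀ {u} → u ∈ Y′ → u ∈ Y ⊎ u ≡ v
    splitY {u} u∈ with v≤u , u≤s ← ∈⟦⟧⁻ (ℕ.suc (toℕ v)) s u∈ with ℕ.m≤n⇒m<n∨m≡n v≤u
    ... | inj₁ v<u = inj₁ (∈⟦⟧⁺ v<u u≤s)
    ... | inj₂ v≡u = inj₂ (Fin.toℕ-injective (ℕ.suc-injective (≡.sym v≡u)))

    Y⇒ : ∀ {u} → u ∈ Y → u ∈ Y′
    Y⇒ u∈ with v<u , u≤s ← ∈⟦⟧⁻ (ℕ.suc (ℕ.suc (toℕ v))) s u∈ = ∈⟦⟧⁺ (ℕ.<⇒≤ v<u) u≤s

    v⇒ : ∀ {u} → u ≡ v → u ∈ Y′
    v⇒ refl = ∈⟦⟧⁺ ℕ.≤-refl v<s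

    notY : ∀ {u} → u ∈ Y → u ≡ v → ⊥
    notY u∈ refl = ℕ.<-irrefl refl (proj₁ (∈⟦⟧⁻ (ℕ.suc (ℕ.suc (toℕ v))) s u∈))

    splitX : ∀ {u} → u ∈ X → u ∈ X′ ⊎ u ≡ v
    splitX {u} u∈ with ℕ.m≤n⇒m<n∨m≡n (proj₂ (∈⟦⟧⁻ 1 (ℕ.suc (toℕ v)) u∈))
    ... | inj₁ u<v = inj₁ (∈⟦⟧⁺ (ℕ.s≤s ℕ.z≤n) (ℕ.s≤s⁻¹ u<v))
    ... | inj₂ u≡v = inj₂ (Fin.toℕ-injective (ℕ.suc-injective u≡v))

    X′⇒ : ∀ {u} → u ∈ X′ → u ∈ X
    X′⇒ u∈ = ∈⟦⟧⁺ (ℕ.s≤s ℕ.z≤n) (ℕ.m≤n⇒m≤1+n (proj₂ (∈⟦⟧⁻ 1 (toℕ v) u∈)))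

    v⇒′ : ∀ {u} → u ≡ v → u ∈ X
    v⇒′ refl = ∈⟦⟧⁺ (ℕ.s≤s ℕ.z≤n) ℕ.≤-refl

    notX : ∀ {u} → u ∈ X′ → u ≡ v → ⊥
    notX u∈ refl = ℕ.<-irrefl refl (proj₂ (∈⟦⟧⁻ 1 (toℕ v) u∈))

    before≡ : arcs (_∈? X′) (Fin._≟ v) ≡ before
    before≡ = ≡.trans (arcs-comm (_∈? X′) (Fin._≟ v)) (≡.trans (arcs-neighbours v (_∈? X′))
      (count-cong (_∈? X′) (before? v) (proj₂ ∘ ∈⟦⟧⁻ 1 (toℕ v)) (∈⟦⟧⁺ (ℕ.s≤s ℕ.z≤n)) (neighbours v)))

    inside≡ : inside ≡ arcs (_∈? Y) (Fin._≟ v)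
    inside≡ = begin
      inside                                              ≡⟨ count-filter (inside? s v) (v ~?_) (allFin n) ⟩
      count (λ u → (v ~? u) ×-dec inside? s v u) (allFin n) ≡⟨ count-cong _ _ to from (allFin n) ⟩
      count (λ u → (v ~? u) ×-dec (u ∈? Y)) (allFin n)      ≡⟨ count-filter (_∈? Y) (v ~?_) (allFin n) ⟨
      count (_∈? Y) (neighbours v)                        ≡⟨ arcs-neighbours v (_∈? Y) ⟨
      arcs (Fin._≟ v) (_∈? Y)                             ≡⟨ arcs-comm (Fin._≟ v) (_∈? Y) ⟩
      arcs (_∈? Y) (Fin._≟ v)                             ∎
      where
      to : ∀ {u} → v ~ u × ¬ (u Fin.< v) × toℕ u ℕ.< s → v ~ u × u ∈ Y
      to {u} (e , u≮v , u<s) = e , ∈⟦⟧⁺ (ℕ.s≤s (ℕ.≤∧≢⇒< (ℕ.≮⇒≥ u≮v) λ eq → irrefl (Fin.toℕ-injective eq) e)) u<s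
      from : ∀ {u} → v ~ u × u ∈ Y → v ~ u × ¬ (u Fin.< v) × toℕ u ℕ.< s
      from {u} (e , u∈Y) with v<u , u≤s ← ∈⟦⟧⁻ (ℕ.suc (ℕ.suc (toℕ v))) s u∈Y = e , ℕ.<⇒≯ (ℕ.s≤s⁻¹ v<u) , u≤s

  -- The handshake lemma: degrees count ordered adjacent pairs, which split by orientation into two
  -- classes that transposition exchanges.
  sum-degree : ListAction.sum (map degree (allFin n)) ≡ ∣E∣ ℕ.+ ∣E∣
  sum-degree = begin
    ListAction.sum (map degree (allFin n))                              ≡⟨ sum-map-tabulate degree (λ v → v) ⟩
    ∑[ u < n ] degree u
      ≡⟨ sum-cong-≗ (λ u → count-tabulate (u ~?_) (λ v → v)) ⟩
    ∑[ u < n ] ∑[ v < n ] 𝟙 (u ~? v)                              ≡⟨ count-pairs (λ (u , v) → u ~? v) ⟨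
    count (λ (u , v) → u ~? v) (pairs n)
      ≡⟨ count-⊎ _ _ _ split proj₂ proj₂ (λ (u<v , _) (v<u , _) → ℕ.<⇒≯ u<v v<u) (pairs n) ⟩
    ∣E∣ ℕ.+ count (λ (u , v) → (v Fin.<? u) ×-dec (u ~? v)) (pairs n)   ≡⟨ cong (∣E∣ ℕ.+_) flip ⟩
    ∣E∣ ℕ.+ ∣E∣                                                     ∎
    where
    open ≡.≡-Reasoning
    sum-map-tabulate : ∀ {m} (f : A → ℕ) (g : Fin m → A) → ListAction.sum (map f (tabulate g)) ≡ ∑[ i < m ] f (g i)
    sum-map-tabulate {m = ℕ.zero}  f g = refl
    sum-map-tabulate {m = ℕ.suc m} f g = cong (f (g Fin.zero) ℕ.+_) (sum-map-tabulate f (g ∘ Fin.suc))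
    split : ∀ {e@(u , v) : Fin n × Fin n} → u ~ v → (u Fin.< v × u ~ v) ⊎ (v Fin.< u × u ~ v)
    split {u , v} e with Fin.<-cmp u v
    ... | tri< u<v _ _ = inj₁ (u<v , e)
    ... | tri≈ _ u≡v _ = contradiction e (irrefl u≡v)
    ... | tri> _ _ v<u = inj₂ (v<u , e)
    flip : count (λ (u , v) → (v Fin.<? u) ×-dec (u ~? v)) (pairs n) ≡ ∣E∣
    flip = ≡.trans (count-swap (λ (u , v) → (v Fin.<? u) ×-dec (u ~? v)))
      (count-cong (λ (v , u) → (v Fin.<? u) ×-dec (u ~? v)) (λ (v , u) → (v Fin.<? u) ×-dec (v ~? u))
        (λ (p , e) → p , ~-sym e) (λ (p , e) → p , ~-sym e) (pairs n))

-- Partitions of initial segments, their cut edges, and connectedness of intervals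

record PartitionUpTo {n} (s : ℕ) (P : List (Subset n)) : Set where
  field
    bounded  : ∀ i {v} → v ∈ lookup P i → toℕ v ℕ.< s
    disjoint : ∀ {i j} → i ≢ j → ∀ {v} → v ∈ lookup P i → v ∉ lookup P j
    covers   : ∀ v → toℕ v ℕ.< s → ∃[ i ] v ∈ lookup P i

open PartitionUpTo

partitionUpTo-[] : PartitionUpTo {n} 0 []
partitionUpTo-[] = record { bounded = λ () ; disjoint = λ { {()} } ; covers = λ _ () }

partitionUpTo-∷ : ∀ {P : List (Subset n)} → r ℕ.≤ s →
                  PartitionUpTo r P → PartitionUpTo s (⟦ ℕ.suc r , s ⟧ ∷ P)
partitionUpTo-∷ {n} {r} {s} {P} r≤s part = record
  { bounded  = λ { Fin.zero v∈ → proj₂ (∈⟦⟧⁻ (ℕ.suc r) s v∈)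
                 ; (Fin.suc i) v∈ → ℕ.<-≤-trans (bounded part i v∈) r≤s }
  ; disjoint = disjoint′
  ; covers   = covers′
  }
  where
  disjoint′ : ∀ {i j : Fin (ℕ.suc (length P))} → i ≢ j → ∀ {v} →
              v ∈ lookup (⟦ ℕ.suc r , s ⟧ ∷ P) i → v ∉ lookup (⟦ ℕ.suc r , s ⟧ ∷ P) j
  disjoint′ {Fin.zero}  {Fin.zero}  i≢j v∈ v∈′ = i≢j refl
  disjoint′ {Fin.zero}  {Fin.suc j} i≢j v∈ v∈′ = ℕ.<⇒≱ (proj₁ (∈⟦⟧⁻ (ℕ.suc r) s v∈)) (bounded part j v∈′)
  disjoint′ {Fin.suc i} {Fin.zero}  i≢j v∈ v∈′ = ℕ.<⇒≱ (proj₁ (∈⟦⟧⁻ (ℕ.suc r) s v∈′)) (bounded part i v∈)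
  disjoint′ {Fin.suc i} {Fin.suc j} i≢j v∈ v∈′ = disjoint part (i≢j ∘ cong Fin.suc) v∈ v∈′

  covers′ : ∀ v → toℕ v ℕ.< s → ∃[ i ] v ∈ lookup (⟦ ℕ.suc r , s ⟧ ∷ P) i
  covers′ v v<s with ℕ.<-≤-connex (toℕ v) r
  ... | inj₁ v<r with i , v∈ ← covers part v v<r = Fin.suc i , v∈
  ... | inj₂ r≤v = Fin.zero , ∈⟦⟧⁺ (ℕ.s≤s r≤v) v<s

-- The parts i′ and j′ of Q containing u and v occur in P as well. Were they the same part,
-- disjointness in P would make both i and j the index of that part.
inDifferentParts-⊇ : {P Q : List (Subset n)} → PartitionUpTo n P → PartitionUpTo n Q →
                     (∀ {X} → X List.∈ Q → X List.∈ P) →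
                     ∀ {e} → InDifferentParts P e → InDifferentParts Q e
inDifferentParts-⊇ {n} {P} {Q} partP partQ Q⊆P {u , v} (i , j , i≢j , u∈i , v∈j)
  with i′ , u∈i′ ← covers partQ u (Fin.toℕ<n u)
  with j′ , v∈j′ ← covers partQ v (Fin.toℕ<n v)
  with i′ Fin.≟ j′
... | no  i′≢j′ = i′ , j′ , i′≢j′ , u∈i′ , v∈j′
... | yes refl  = contradiction (≡.trans (same u∈i u∈i′) (≡.sym (same v∈j v∈j′))) i≢j
  where
  X∈P : lookup Q i′ List.∈ P
  X∈P = Q⊆P (List.∈-lookup i′)
  same : ∀ {i x} → x ∈ lookup P i → x ∈ lookup Q i′ → i ≡ Any.index X∈P
  same {i} {x} x∈i x∈i′ with i Fin.≟ Any.index X∈P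
  ... | yes eq = eq
  ... | no neq = contradiction (subst (x ∈_) (Any.lookup-index X∈P) x∈i′) (disjoint partP neq x∈i)

cutEdges-cong : {P Q : List (Subset n)} → PartitionUpTo n P → PartitionUpTo n Q →
                (∀ {X} → X List.∈ P → X List.∈ Q) → (∀ {X} → X List.∈ Q → X List.∈ P) →
                ∀ E → cutEdges E P ≡ cutEdges E Q
cutEdges-cong {P = P} {Q} partP partQ P⊆Q Q⊆P E =
  count-cong (inDifferentParts? P) (inDifferentParts? Q)
    (inDifferentParts-⊇ partP partQ Q⊆P) (inDifferentParts-⊇ partQ partP P⊆Q) E

-- Downward search: X lies strictly below b, so the vertex with `toℕ` equal to b - 1 is the greatest
-- as soon as it belongs to X; otherwise the bound drops by one.
greatest : ∀ {X : Subset n} → Nonempty X → ∃[ m ] m ∈ X × (∀ {u} → u ∈ X → toℕ u ℕ.≤ toℕ m)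
greatest {n} {X} X≠∅ = search n ℕ.≤-refl (λ {u} _ → Fin.toℕ<n u)
  where
  search : ∀ b → b ℕ.≤ n → (∀ {u} → u ∈ X → toℕ u ℕ.< b) → ∃[ m ] m ∈ X × (∀ {u} → u ∈ X → toℕ u ℕ.≤ toℕ m)
  search ℕ.zero    _   below = contradiction (below (proj₂ X≠∅)) λ ()
  search (ℕ.suc b) b<n below with Fin.fromℕ< b<n ∈? X
  ... | yes m∈X = _ , m∈X , λ u∈X → subst (_ ℕ.≤_) (≡.sym (Fin.toℕ-fromℕ< b<n)) (ℕ.s≤s⁻¹ (below u∈X))
  ... | no  m∉X = search b (ℕ.<⇒≤ b<n) λ {u} u∈X →
    ℕ.≤∧≢⇒< (ℕ.s≤s⁻¹ (below u∈X)) λ u≡b →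
      m∉X (subst (_∈ X) (Fin.toℕ-injective (≡.trans u≡b (≡.sym (Fin.toℕ-fromℕ< b<n)))) u∈X)

module CutProperties {n : ℕ} (G : Graph n) where
  open Graph G renaming (sym to ~-sym)

  -- A cut edge avoiding the new block joins two old parts and so lies in {v₁,...,vᵣ}; any other has
  -- one end in the new block and one in an old part. Conversely, an edge crossing into the block is
  -- cut because `covers` places its other end in some old part.
  cutEdges-∷ : ∀ {r s} {P : List (Subset n)} → r ℕ.≤ s → PartitionUpTo r P →
               cutEdges (edgesWithin ⟦ 1 , s ⟧) (⟦ ℕ.suc r , s ⟧ ∷ P) ≡
               cutEdges (edgesWithin ⟦ 1 , r ⟧) P ℕ.+ δ ⟦ 1 , r ⟧ ⟦ ℕ.suc r , s ⟧
  cutEdges-∷ {r} {s} {P} r≤s part = begin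
    cutEdges (edgesWithin ⟦ 1 , s ⟧) (X ∷ P)                             ≡⟨ count-filter _ _ edges ⟩
    count (λ e → within? s e ×-dec inDifferentParts? (X ∷ P) e) edges
      ≡⟨ count-⊎ (λ e → within? s e ×-dec inDifferentParts? (X ∷ P) e) (λ e → within? r e ×-dec inDifferentParts? P e) _
           split old new disjoint′ edges ⟩
    count (λ e → within? r e ×-dec inDifferentParts? P e) edges ℕ.+ δ ⟦ 1 , r ⟧ X
      ≡⟨ cong (ℕ._+ δ ⟦ 1 , r ⟧ X) (count-filter _ _ edges) ⟨
    cutEdges (edgesWithin ⟦ 1 , r ⟧) P ℕ.+ δ ⟦ 1 , r ⟧ X                   ∎
    where
    open ≡.≡-Reasoning
    X = ⟦ ℕ.suc r , s ⟧

    Within : ℕ → Fin n × Fin n → Set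
    Within s (u , v) = u ∈ ⟦ 1 , s ⟧ × v ∈ ⟦ 1 , s ⟧

    within? : ∀ s e → Dec (Within s e)
    within? s (u , v) = (u ∈? ⟦ 1 , s ⟧) ×-dec (v ∈? ⟦ 1 , s ⟧)

    Crossing : Fin n × Fin n → Set
    Crossing (u , v) = (u ∈ ⟦ 1 , r ⟧ × v ∈ X) ⊎ (u ∈ X × v ∈ ⟦ 1 , r ⟧)

    low : ∀ i {v} → v ∈ lookup P i → v ∈ ⟦ 1 , r ⟧
    low i v∈ = ∈⟦⟧⁺ (ℕ.s≤s ℕ.z≤n) (bounded part i v∈)

    widen : ∀ {v} → v ∈ ⟦ 1 , r ⟧ → v ∈ ⟦ 1 , s ⟧
    widen v∈ = ∈⟦⟧⁺ (ℕ.s≤s ℕ.z≤n) (ℕ.≤-trans (proj₂ (∈⟦⟧⁻ 1 r v∈)) r≤s)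

    widen′ : ∀ {v} → v ∈ X → v ∈ ⟦ 1 , s ⟧
    widen′ v∈ = ∈⟦⟧⁺ (ℕ.s≤s ℕ.z≤n) (proj₂ (∈⟦⟧⁻ (ℕ.suc r) s v∈))

    apart : ∀ {v} → v ∈ ⟦ 1 , r ⟧ → v ∈ X → ⊥
    apart v∈ v∈X = ℕ.<⇒≱ (proj₁ (∈⟦⟧⁻ (ℕ.suc r) s v∈X)) (proj₂ (∈⟦⟧⁻ 1 r v∈))

    split : ∀ {e} → Within s e × InDifferentParts (X ∷ P) e →
            (Within r e × InDifferentParts P e) ⊎ Crossing e
    split (_ , Fin.zero  , Fin.zero  , i≢j , _) = contradiction refl i≢j
    split (_ , Fin.zero  , Fin.suc j , _ , u∈ , v∈) = inj₂ (inj₂ (u∈ , low j v∈))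
    split (_ , Fin.suc i , Fin.zero  , _ , u∈ , v∈) = inj₂ (inj₁ (low i u∈ , v∈))
    split (_ , Fin.suc i , Fin.suc j , i≢j , u∈ , v∈) =
      inj₁ ((low i u∈ , low j v∈) , i , j , i≢j ∘ cong Fin.suc , u∈ , v∈)

    old : ∀ {e} → Within r e × InDifferentParts P e → Within s e × InDifferentParts (X ∷ P) e
    old ((u∈ , v∈) , i , j , i≢j , u∈i , v∈j) =
      (widen u∈ , widen v∈) , Fin.suc i , Fin.suc j , i≢j ∘ Fin.suc-injective , u∈i , v∈j

    new : ∀ {e} → Crossing e → Within s e × InDifferentParts (X ∷ P) e
    new {u , v} (inj₁ (u∈ , v∈)) with i , u∈i ← covers part u (proj₂ (∈⟦⟧⁻ 1 r u∈)) =
      (widen u∈ , widen′ v∈) , Fin.suc i , Fin.zero , (λ ()) , u∈i , v∈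
    new {u , v} (inj₂ (u∈ , v∈)) with j , v∈j ← covers part v (proj₂ (∈⟦⟧⁻ 1 r v∈)) =
      (widen′ u∈ , widen v∈) , Fin.zero , Fin.suc j , (λ ()) , u∈ , v∈j

    disjoint′ : ∀ {e} → Within r e × InDifferentParts P e → Crossing e → ⊥
    disjoint′ ((_ , v∈) , _) (inj₁ (_ , v∈X)) = apart v∈ v∈X
    disjoint′ ((u∈ , _) , _) (inj₂ (u∈X , _)) = apart u∈ u∈X

  cutEdges-all : ∀ P → cutEdges (edgesWithin ⟦ 1 , n ⟧) P ≡ cutEdges edges P
  cutEdges-all P = ≡.trans (count-filter (inDifferentParts? P) _ edges)
    (count-cong _ (inDifferentParts? P) proj₂ (λ {(u , v)} d → (all u , all v) , d) edges)
    where
    all : ∀ v → v ∈ ⟦ 1 , n ⟧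
    all v = ∈⟦⟧⁺ (ℕ.s≤s ℕ.z≤n) (Fin.toℕ<n v)

  -- The stretch of the Hamiltonian path from the earlier to the later vertex stays inside the
  -- interval; symmetry of adjacency gives the opposite direction.
  interval-connected : OrderingIsHamiltonianPath → ∀ r s → Connected ⟦ r , s ⟧
  interval-connected path r s {u} {v} u∈ v∈ = Sum.[_,_]′
      (λ u≤v → ascend _ u∈ v∈ (ℕ.m∸n+n≡m u≤v))
      (λ v≤u → reverseStar (ascend _ v∈ u∈ (ℕ.m∸n+n≡m v≤u)))
      (ℕ.≤-total (toℕ u) (toℕ v))
    where
    reverseStar : ∀ {u v} → Star (Induced ⟦ r , s ⟧) u v → Star (Induced ⟦ r , s ⟧) v u
    reverseStar = Star.reverse λ (x∈ , y∈ , x~y) → y∈ , x∈ , ~-sym x~y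
    ascend : ∀ d {u v} → u ∈ ⟦ r , s ⟧ → v ∈ ⟦ r , s ⟧ → d ℕ.+ toℕ u ≡ toℕ v → Star (Induced ⟦ r , s ⟧) u v
    ascend ℕ.zero    {u} {v} u∈ v∈ eq with refl ← Fin.toℕ-injective {i = u} {j = v} eq = Star.ε
    ascend (ℕ.suc d) {u} {v} u∈ v∈ eq = (u∈ , u⁺∈ , path u u⁺ u⁺≡) ◅ ascend d u⁺∈ v∈ eq′
      where
      eq″ : d ℕ.+ ℕ.suc (toℕ u) ≡ toℕ v
      eq″ = ≡.trans (ℕ.+-suc d (toℕ u)) eq
      u<v : toℕ u ℕ.< toℕ v
      u<v = ℕ.≤-trans (ℕ.m≤n+m (ℕ.suc (toℕ u)) d) (ℕ.≤-reflexive eq″)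
      u⁺<n : ℕ.suc (toℕ u) ℕ.< n
      u⁺<n = ℕ.≤-<-trans u<v (Fin.toℕ<n v)
      u⁺ : Fin n
      u⁺ = Fin.fromℕ< u⁺<n
      u⁺≡ : toℕ u⁺ ≡ ℕ.suc (toℕ u)
      u⁺≡ = Fin.toℕ-fromℕ< u⁺<n
      u⁺∈ : u⁺ ∈ ⟦ r , s ⟧
      u⁺∈ = ∈⟦⟧⁺
        (subst (λ x → r ℕ.≤ ℕ.suc x) (≡.sym u⁺≡) (ℕ.m≤n⇒m≤1+n (proj₁ (∈⟦⟧⁻ r s u∈))))
        (subst (λ x → ℕ.suc x ℕ.≤ s) (≡.sym u⁺≡) (ℕ.≤-trans (ℕ.s≤s u<v) (proj₂ (∈⟦⟧⁻ r s v∈))))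
      eq′ : d ℕ.+ toℕ u⁺ ≡ toℕ v
      eq′ = ≡.trans (cong (d ℕ.+_) u⁺≡) eq″

-- Sequences of intervals and consistent partitions

-- Blocks s t bs: bs, in the order in which the program stores it, cuts {v₁,…,vₛ} into t fitting blocks.
-- Chain s t bs: bs, in increasing order, cuts {vₛ₊₁,…,vₙ} into t fitting blocks.
module Intervals {ℓ} (n : ℕ) (Fits : ℕ → ℕ → Set ℓ) where

  infixr 5 _∷_

  data Blocks : ℕ → ℕ → List (ℕ × ℕ) → Set ℓ where
    []  : Blocks 0 0 []
    _∷_ : ∀ {r s t bs} → r ℕ.< s × Fits s (ℕ.suc r) → Blocks r t bs →
          Blocks s (ℕ.suc t) ((ℕ.suc r , s) ∷ bs)

  data Chain : ℕ → ℕ → List (ℕ × ℕ) → Set ℓ where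
    []  : Chain n 0 []
    _∷_ : ∀ {r s t bs} → r ℕ.< s × Fits s (ℕ.suc r) → Chain s t bs →
          Chain r (ℕ.suc t) ((ℕ.suc r , s) ∷ bs)

  blocks-length : ∀ {s t bs} → Blocks s t bs → length bs ≡ t
  blocks-length []       = refl
  blocks-length (_ ∷ bs) = cong ℕ.suc (blocks-length bs)

  blocks-≤ : ∀ {s t bs} → Blocks s t bs → t ℕ.≤ s
  blocks-≤ []              = ℕ.z≤n
  blocks-≤ ((r<s , _) ∷ b) = ℕ.≤-<-trans (blocks-≤ b) r<s

  -- Blocks move one at a time from the prefix of the ordering to the suffix, which is exactly what
  -- `reverseAcc` does to the two lists. With an empty suffix this is the reversal made by the
  -- program.
  blocks⇒chain : ∀ {s t u bs cs} → Blocks s t bs → Chain s u cs → Chain 0 (t ℕ.+ u) (reverseAcc cs bs)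
  blocks⇒chain []      c = c
  blocks⇒chain {u = u} {cs = cs} (_∷_ {r} {s} {t} {bs} x b) c =
    subst (λ m → Chain 0 m (reverseAcc ((ℕ.suc r , s) ∷ cs) bs)) (ℕ.+-suc t u) (blocks⇒chain b (x ∷ c))

  chain⇒blocks : ∀ {s t u bs cs} → Chain s u cs → Blocks s t bs → Blocks n (u ℕ.+ t) (reverseAcc bs cs)
  chain⇒blocks []      b = b
  chain⇒blocks {t = t} {bs = bs} (_∷_ {r} {s} {u} {cs} x c) b =
    subst (λ m → Blocks n m (reverseAcc ((ℕ.suc r , s) ∷ bs) cs)) (ℕ.+-suc u t) (chain⇒blocks c (x ∷ b))

  chain-≤n : ∀ {s t bs} → Chain s t bs → s ℕ.≤ n
  chain-≤n []              = ℕ.≤-refl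
  chain-≤n ((r<s , _) ∷ c) = ℕ.≤-trans (ℕ.<⇒≤ r<s) (chain-≤n c)

  chain-length : ∀ {s t bs} → Chain s t bs → length bs ≡ t
  chain-length []      = refl
  chain-length (_ ∷ c) = cong ℕ.suc (chain-length c)

  parts : List (ℕ × ℕ) → List (Subset n)
  parts = map ⟦_⟧

  blocks-partition : ∀ {s t bs} → Blocks s t bs → PartitionUpTo s (parts bs)
  blocks-partition []              = partitionUpTo-[]
  blocks-partition ((r<s , _) ∷ b) = partitionUpTo-∷ (ℕ.<⇒≤ r<s) (blocks-partition b)

  chain-lower : ∀ {s t bs} → Chain s t bs → ∀ i {v} → v ∈ lookup (parts bs) i → s ℕ.≤ toℕ v
  chain-lower {s} (_∷_ {s = s′} _ c) Fin.zero    v∈ = ℕ.s≤s⁻¹ (proj₁ (∈⟦⟧⁻ (ℕ.suc s) s′ v∈))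
  chain-lower {s} ((r<s , _) ∷ c)    (Fin.suc i) v∈ = ℕ.≤-trans (ℕ.<⇒≤ r<s) (chain-lower c i v∈)

  chain-covers : ∀ {s t bs} → Chain s t bs → ∀ v → s ℕ.≤ toℕ v → ∃[ i ] v ∈ lookup (parts bs) i
  chain-covers []      v n≤v = contradiction (Fin.toℕ<n v) (ℕ.≤⇒≯ n≤v)
  chain-covers (_∷_ {s = s} _ c) v r≤v with ℕ.<-≤-connex (toℕ v) s
  ... | inj₁ v<s = Fin.zero , ∈⟦⟧⁺ (ℕ.s≤s r≤v) v<s
  ... | inj₂ s≤v with i , v∈ ← chain-covers c v s≤v = Fin.suc i , v∈

  chain-nonempty : ∀ {s t bs} → Chain s t bs → ∀ i → Nonempty (lookup (parts bs) i)
  chain-nonempty {r} ((r<s , _) ∷ c) Fin.zero    = Fin.fromℕ< r<n ,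
    ∈⟦⟧⁺ (ℕ.≤-reflexive (cong ℕ.suc (≡.sym eq))) (ℕ.≤-trans (ℕ.≤-reflexive (cong ℕ.suc eq)) r<s)
    where
    r<n = ℕ.≤-trans r<s (chain-≤n c)
    eq  = Fin.toℕ-fromℕ< r<n
  chain-nonempty (_ ∷ c)               (Fin.suc i) = chain-nonempty c i

  chain-consistent : ∀ {s t bs} → Chain s t bs → Consistent (parts bs)
  chain-consistent {r} (_∷_ {s = s} _ c) {Fin.zero}  {Fin.suc j} _   u∈ v∈ =
    ℕ.<-≤-trans (proj₂ (∈⟦⟧⁻ (ℕ.suc r) s u∈)) (chain-lower c j v∈)
  chain-consistent (_ ∷ c) {Fin.suc i} {Fin.suc j} i<j u∈ v∈ = chain-consistent c (ℕ.s<s⁻¹ i<j) u∈ v∈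

  consistent⇒disjoint : ∀ {P : List (Subset n)} → Consistent P →
                        ∀ {i j} → i ≢ j → ∀ {v} → v ∈ lookup P i → v ∉ lookup P j
  consistent⇒disjoint cons {i} {j} i≢j v∈i v∈j with Fin.<-cmp i j
  ... | tri< i<j _ _ = ℕ.<-irrefl refl (cons i<j v∈i v∈j)
  ... | tri≈ _ i≡j _ = i≢j i≡j
  ... | tri> _ _ j<i = ℕ.<-irrefl refl (cons j<i v∈j v∈i)

  chain-isPartition : ∀ {t bs} → Chain 0 t bs → IsPartition (parts bs)
  chain-isPartition {bs = bs} c = record
    { nonempty = chain-nonempty c
    ; disjoint = consistent⇒disjoint {parts bs} (chain-consistent c)
    ; covers   = λ v → chain-covers c v ℕ.z≤n
    }

  partition⇒upTo : {P : List (Subset n)} → IsPartition P → PartitionUpTo n P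
  partition⇒upTo part = record
    { bounded  = λ _ {v} _ → Fin.toℕ<n v
    ; disjoint = IsPartition.disjoint part
    ; covers   = λ v _ → IsPartition.covers part v
    }

  chain-lookup : ∀ {s t bs} → Chain s t bs → ∀ i →
                 ∃[ r ] ∃[ s ] Fits s r × lookup (parts bs) i ≡ ⟦ r , s ⟧
  chain-lookup ((_ , fits) ∷ c) Fin.zero    = _ , _ , fits , refl
  chain-lookup (_ ∷ c)          (Fin.suc i) = chain-lookup c i

  -- Which edges are cut depends only on the set of parts, and reversal keeps that set.
  cutEdges-reverse : ∀ {t bs} → Blocks n t bs → ∀ E → cutEdges E (parts (reverse bs)) ≡ cutEdges E (parts bs)
  cutEdges-reverse {bs = bs} b = cutEdges-cong
    (partition⇒upTo (chain-isPartition (blocks⇒chain b []))) (blocks-partition b)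
    (λ X∈ → Any.reverse⁻ (subst (_ List.∈_) (List.reverse-map ⟦_⟧ bs) X∈))
    (λ X∈ → subst (_ List.∈_) (≡.sym (List.reverse-map ⟦_⟧ bs)) (Any.reverse⁺ X∈))

  module _ {g} {Good : Subset n → Set g} (good⇒fits : ∀ {r s} → Good ⟦ r , s ⟧ → Fits s r) where

    -- The induction runs over partitions of {vₛ₊₁,...,vₙ}. Let m be the greatest vertex of the
    -- first part X. By consistency all later parts lie after m, so covering forces every vertex up
    -- to m into X. Thus X is an interval, and the remaining parts partition what follows m.
    partition⇒chain : ∀ {s} Q → s ℕ.≤ n →
      (∀ i → Nonempty (lookup Q i)) → Consistent Q → (∀ i → Good (lookup Q i)) →
      (∀ i {v} → v ∈ lookup Q i → s ℕ.≤ toℕ v) → (∀ v → s ℕ.≤ toℕ v → ∃[ i ] v ∈ lookup Q i) →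
      ∃[ bs ] Chain s (length Q) bs × parts bs ≡ Q
    partition⇒chain {s} [] s≤n nonempty cons good lower covers with ℕ.m≤n⇒m<n∨m≡n s≤n
    ... | inj₂ refl = [] , [] , refl
    ... | inj₁ s<n with () , _ ← covers (Fin.fromℕ< s<n) (ℕ.≤-reflexive (≡.sym (Fin.toℕ-fromℕ< s<n)))
    partition⇒chain {r} (X ∷ Q) r≤n nonempty cons good lower covers = extend (greatest (nonempty Fin.zero))
      where
      extend : ∃[ m ] m ∈ X × (∀ {u} → u ∈ X → toℕ u ℕ.≤ toℕ m) →
               ∃[ bs ] Chain r (ℕ.suc (length Q)) bs × parts bs ≡ X ∷ Q
      extend (m , m∈X , X≤m) =
        let bs , chain , parts≡ = partition⇒chain {ℕ.suc (toℕ m)} Q (Fin.toℕ<n m)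
              (nonempty ∘ Fin.suc) (λ i<j → cons (ℕ.s<s i<j)) (good ∘ Fin.suc)
              (λ i v∈ → cons {Fin.zero} {Fin.suc i} ℕ.z<s m∈X v∈) covers′
        in (ℕ.suc r , ℕ.suc (toℕ m)) ∷ bs
         , (ℕ.s≤s (lower Fin.zero m∈X) , good⇒fits (subst Good X≡ (good Fin.zero))) ∷ chain
         , cong₂ _∷_ (≡.sym X≡) parts≡
        where
        covers′ : ∀ v → toℕ m ℕ.< toℕ v → ∃[ i ] v ∈ lookup Q i
        covers′ v m<v with covers v (ℕ.≤-trans (lower Fin.zero m∈X) (ℕ.<⇒≤ m<v))
        ... | Fin.zero  , v∈X = contradiction (X≤m v∈X) (ℕ.<⇒≱ m<v)
        ... | Fin.suc i , v∈  = i , v∈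
        X⊇ : ⟦ ℕ.suc r , ℕ.suc (toℕ m) ⟧ ⊆ X
        X⊇ {v} v∈ with r<v , v≤m ← ∈⟦⟧⁻ (ℕ.suc r) (ℕ.suc (toℕ m)) v∈ with covers v (ℕ.s≤s⁻¹ r<v)
        ... | Fin.zero  , v∈X = v∈X
        ... | Fin.suc i , v∈Q = contradiction v≤m (ℕ.<⇒≱ (ℕ.s≤s (cons {Fin.zero} {Fin.suc i} ℕ.z<s m∈X v∈Q)))
        X≡ : X ≡ ⟦ ℕ.suc r , ℕ.suc (toℕ m) ⟧
        X≡ = ⊆-antisym (λ v∈X → ∈⟦⟧⁺ (ℕ.s≤s (lower Fin.zero v∈X)) (ℕ.s≤s (X≤m v∈X))) X⊇

-- Reasoning about branches, loops and arrays

if-elim : ∀ {P : Set p} {x y : A} (Q : A → Set q) (P? : Dec P) →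
          (P → Q x) → (¬ P → Q y) → Q (if does P? then x else y)
if-elim Q (yes p) f g = f p
if-elim Q (no ¬p) f g = g ¬p

-- The shape of the stopping test of `scan`. The second branch receives no evidence, since either
-- conjunct may have failed.
if-∧-elim : ∀ {P : Set p} {x y : A} (Q : A → Set q) b (P? : Dec P) → (b ≡ true → P → Q x) → Q y →
            Q (if b ∧ does P? then x else y)
if-∧-elim Q false P?      f g = g
if-∧-elim Q true  (yes p) f g = f refl p
if-∧-elim Q true  (no _)  f g = g

∧-true⁻ : {P : Set p} (P? : Dec P) {b : Bool} → does P? ∧ b ≡ true → P × b ≡ true
∧-true⁻ (yes p) eq = p , eq

-- The worker of `for` is local to it; this equation and `for-stop` let loops be unfolded without
-- mentioning it.
for-step : ∀ {lo hi} (body : ℕ → S → Timed S) x → lo ℕ.≤ hi →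
           for lo hi body x ≡ (tick >> body lo x >>= for (ℕ.suc lo) hi body)
for-step body x lo≤hi rewrite ℕ.+-∸-assoc 1 lo≤hi = refl

for-stop : ∀ {lo hi} (body : ℕ → S → Timed S) x → hi ℕ.< lo → for lo hi body x ≡ (tick >> return x)
for-stop body x hi<lo rewrite ℕ.m≤n⇒m∸n≡0 hi<lo = refl

-- The maximum is the index at which the loop ends: `lo` if the range is empty, one past `hi`
-- otherwise.
for-value : ∀ lo hi (body : ℕ → S → Timed S) (I : ℕ → S → Set p) →
            (∀ i x → lo ℕ.≤ i → i ℕ.≤ hi → I i x → I (ℕ.suc i) (value (body i x))) →
            ∀ x → I lo x → I (lo ℕ.⊔ ℕ.suc hi) (value (for lo hi body x))
for-value lo hi body I step x Ilo = go (ℕ.suc hi ℕ.∸ lo) lo refl ℕ.≤-refl x Ilo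
  where
  go : ∀ m i → ℕ.suc hi ℕ.∸ i ≡ m → lo ℕ.≤ i → ∀ x → I i x → I (i ℕ.⊔ ℕ.suc hi) (value (for i hi body x))
  go m i eq lo≤i x Ii with ℕ.≤-<-connex i hi
  go m i eq lo≤i x Ii | inj₂ hi<i
    rewrite for-stop body x hi<i | ℕ.m≥n⇒m⊔n≡m hi<i = Ii
  go ℕ.zero i eq lo≤i x Ii | inj₁ i≤hi = contradiction (ℕ.m∸n≡0⇒m≤n eq) (ℕ.<⇒≱ (ℕ.s≤s i≤hi))
  go (ℕ.suc m) i eq lo≤i x Ii | inj₁ i≤hi
    rewrite for-step body x i≤hi | ≡.trans (ℕ.m≤n⇒m⊔n≡n (ℕ.m≤n⇒m≤1+n i≤hi)) (≡.sym (ℕ.m≤n⇒m⊔n≡n (ℕ.s≤s i≤hi))) =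
    go m (ℕ.suc i) (ℕ.suc-injective (≡.trans (≡.sym (ℕ.+-∸-assoc 1 i≤hi)) eq)) (ℕ.m≤n⇒m≤1+n lo≤i) _ (step i x lo≤i i≤hi Ii)

for-steps : ∀ lo hi (body : ℕ → S → Timed S) b → (∀ i x → steps (body i x) ℕ.≤ b) →
            ∀ x → steps (for lo hi body x) ℕ.≤ ℕ.suc ((ℕ.suc hi ℕ.∸ lo) ℕ.* ℕ.suc b)
for-steps lo hi body b body≤ = go _ lo refl
  where
  go : ∀ m i → ℕ.suc hi ℕ.∸ i ≡ m → ∀ x → steps (for i hi body x) ℕ.≤ ℕ.suc (m ℕ.* ℕ.suc b)
  go m i eq x with ℕ.≤-<-connex i hi
  go m i eq x | inj₂ hi<i rewrite for-stop body x hi<i = ℕ.s≤s ℕ.z≤n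
  go ℕ.zero i eq x | inj₁ i≤hi = contradiction (ℕ.m∸n≡0⇒m≤n eq) (ℕ.<⇒≱ (ℕ.s≤s i≤hi))
  go (ℕ.suc m) i eq x | inj₁ i≤hi rewrite for-step body x i≤hi = begin
    ℕ.suc (steps (body i x) ℕ.+ steps (for (ℕ.suc i) hi body (value (body i x))))
      ≤⟨ ℕ.s≤s (ℕ.+-mono-≤ (body≤ i x) (go m (ℕ.suc i) (ℕ.suc-injective (≡.trans (≡.sym (ℕ.+-∸-assoc 1 i≤hi)) eq)) _)) ⟩
    ℕ.suc (b ℕ.+ ℕ.suc (m ℕ.* ℕ.suc b))   ≡⟨ cong ℕ.suc (ℕ.+-suc b _) ⟩
    ℕ.suc (ℕ.suc m ℕ.* ℕ.suc b)           ∎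
    where open ℕ.≤-Reasoning

read-write-same : (arr : Array A) → ∀ i j x → value (write arr i j x) i j ≡ x
read-write-same arr i j x = if-elim (_≡ x) ((i ℕ.≟ i) ×-dec (j ℕ.≟ j))
  (λ _ → refl) (λ neq → contradiction (refl , refl) neq)

read-write-other : (arr : Array A) → ∀ i j x {i′ j′} → (i′ , j′) ≢ (i , j) →
                   value (write arr i j x) i′ j′ ≡ arr i′ j′
read-write-other arr i j x {i′} {j′} neq = if-elim (_≡ arr i′ j′) ((i′ ℕ.≟ i) ×-dec (j′ ℕ.≟ j))
  (λ { (refl , refl) → contradiction refl neq }) (λ _ → refl)

-- The list vⱼ, ..., v₁ with j as an index, so that recursion along the list keeps track of the
-- position of the scan.
data Down {n} : ℕ → List (Fin n) → Set where
  []  : Down 0 []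
  _∷_ : ∀ v {vs} → Down (toℕ v) vs → Down (ℕ.suc (toℕ v)) (v ∷ vs)

-- Values computed by the subroutines

module Subroutines {c ℓ₁ ℓ₂} (F : ArchimedeanOrderedField c ℓ₁ ℓ₂) {n : ℕ} (G : Graph n)
  (w : Vector (ArchimedeanOrderedField.Carrier F) n) (k : ℕ) (ε : ArchimedeanOrderedField.Carrier F) where

  open ArchimedeanOrderedField F hiding (refl; sym; trans)
  open OrderedFieldProperties F
  open Graph G using (neighbours; δ)
  open GraphProperties G
  open Weights F
  open DynamicPartition F G w k ε

  totalWeight-value : ∀ {m} (f : Fin m → Fin n) → value (totalWeight (tabulate f)) ≡ sum (w ∘ f)
  totalWeight-value {ℕ.zero}  f = refl
  totalWeight-value {ℕ.suc m} f = cong (w (f Fin.zero) +_) (totalWeight-value (f ∘ Fin.suc))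

  allPositive-value⁻ : ∀ {m} (f : Fin m → Fin n) → value (allPositive (tabulate f)) ≡ true → ∀ i → 0# < w (f i)
  allPositive-value⁻ {ℕ.suc m} f eq Fin.zero    = proj₁ (∧-true⁻ (0# <? w (f Fin.zero)) eq)
  allPositive-value⁻ {ℕ.suc m} f eq (Fin.suc i) =
    allPositive-value⁻ (f ∘ Fin.suc) (proj₂ (∧-true⁻ (0# <? w (f Fin.zero)) eq)) i

  allPositive-value⁺ : ∀ {m} (f : Fin m → Fin n) → (∀ i → 0# < w (f i)) → value (allPositive (tabulate f)) ≡ true
  allPositive-value⁺ {ℕ.zero}  f 0<w = refl
  allPositive-value⁺ {ℕ.suc m} f 0<w =
    cong₂ _∧_ (dec-true (0# <? w (f Fin.zero)) (0<w Fin.zero)) (allPositive-value⁺ (f ∘ Fin.suc) (0<w ∘ Fin.suc))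

  -- Each neighbour before v adds one and each inside removes one; the removals are put on the left
  -- to avoid subtraction. The hypothesis keeps d positive whenever `pred` is applied, so truncation
  -- never takes effect.
  updateδ-value : ∀ s v us d → count (inside? s v) us ℕ.≤ d →
                  value (updateδ s v us d) ℕ.+ count (inside? s v) us ≡ d ℕ.+ count (before? v) us
  updateδ-value s v []       d _ = refl
  updateδ-value s v (u ∷ us) d inside≤d = if-elim
    (λ m → value m ℕ.+ inside (u ∷ us) ≡ d ℕ.+ before (u ∷ us))
    (u Fin.<? v)
    (λ u<v → let eq = cong length (List.filter-reject (inside? s v) {u} {us} λ (u≮v , _) → u≮v u<v) in begin
      value (updateδ s v us (ℕ.suc d)) ℕ.+ inside (u ∷ us) ≡⟨ cong (_ ℕ.+_) eq ⟩
      value (updateδ s v us (ℕ.suc d)) ℕ.+ inside us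
        ≡⟨ updateδ-value s v us (ℕ.suc d) (ℕ.m≤n⇒m≤1+n (subst (ℕ._≤ d) eq inside≤d)) ⟩
      ℕ.suc d ℕ.+ before us         ≡⟨ ℕ.+-suc d _ ⟨
      d ℕ.+ ℕ.suc (before us)       ≡⟨ cong (d ℕ.+_) (cong length (List.filter-accept (before? v) {u} {us} u<v)) ⟨
      d ℕ.+ before (u ∷ us)         ∎)
    (λ u≮v → if-elim
      (λ m → value m ℕ.+ inside (u ∷ us) ≡ d ℕ.+ before (u ∷ us))
      (ℕ.suc (toℕ u) ℕ.≤? s)
      (λ u<s → decrement u≮v (cong length (List.filter-accept (inside? s v) {u} {us} (u≮v , u<s))) inside≤d)
      (λ u≮s → let eq = cong length (List.filter-reject (inside? s v) {u} {us} λ (_ , u<s) → u≮s u<s) in begin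
        value (updateδ s v us d) ℕ.+ inside (u ∷ us) ≡⟨ cong (_ ℕ.+_) eq ⟩
        value (updateδ s v us d) ℕ.+ inside us       ≡⟨ updateδ-value s v us d (subst (ℕ._≤ d) eq inside≤d) ⟩
        d ℕ.+ before us                              ≡⟨ cong (d ℕ.+_) (skip u≮v) ⟨
        d ℕ.+ before (u ∷ us)                        ∎))
    where
    open ≡.≡-Reasoning
    inside before : List (Fin n) → ℕ
    inside = count (inside? s v)
    before = count (before? v)
    skip : ¬ u Fin.< v → before (u ∷ us) ≡ before us
    skip u≮v = cong length (List.filter-reject (before? v) {u} {us} u≮v)
    decrement : ∀ {d} → ¬ u Fin.< v → inside (u ∷ us) ≡ ℕ.suc (inside us) → inside (u ∷ us) ℕ.≤ d →
                value (updateδ s v us (pred d)) ℕ.+ inside (u ∷ us) ≡ d ℕ.+ before (u ∷ us)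
    decrement {d} u≮v eq inside≤d with d | subst (ℕ._≤ d) eq inside≤d
    ... | ℕ.suc d | inside≤ = begin
      value (updateδ s v us d) ℕ.+ inside (u ∷ us)     ≡⟨ cong (_ ℕ.+_) eq ⟩
      value (updateδ s v us d) ℕ.+ ℕ.suc (inside us)   ≡⟨ ℕ.+-suc _ _ ⟩
      ℕ.suc (value (updateδ s v us d) ℕ.+ inside us)   ≡⟨ cong ℕ.suc (updateδ-value s v us d (ℕ.s≤s⁻¹ inside≤)) ⟩
      ℕ.suc d ℕ.+ before us                            ≡⟨ cong (ℕ.suc d ℕ.+_) (skip u≮v) ⟨
      ℕ.suc d ℕ.+ before (u ∷ us)                      ∎

  -- By `δ-step` the old cut is m + `inside`, which is at least `inside` as `updateδ-value`
  -- requires. Cancelling `inside` leaves m + `before`, the new cut.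
  updateδ-δ : ∀ {s} (v : Fin n) → toℕ v ℕ.< s →
              value (updateδ s v (neighbours v) (δ ⟦ 1 , ℕ.suc (toℕ v) ⟧ ⟦ ℕ.suc (ℕ.suc (toℕ v)) , s ⟧)) ≡
              δ ⟦ 1 , toℕ v ⟧ ⟦ ℕ.suc (toℕ v) , s ⟧
  updateδ-δ {s} v v<s with m , δ′≡ , δ≡ ← δ-step v v<s rewrite δ′≡ | δ≡ = ℕ.+-cancelʳ-≡ inside _ _ (begin
    value (updateδ s v (neighbours v) (m ℕ.+ inside)) ℕ.+ inside
      ≡⟨ updateδ-value s v (neighbours v) (m ℕ.+ inside) (ℕ.m≤n+m inside m) ⟩
    m ℕ.+ inside ℕ.+ before                                      ≡⟨ ℕ.+-assoc m inside before ⟩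
    m ℕ.+ (inside ℕ.+ before)                                    ≡⟨ cong (m ℕ.+_) (ℕ.+-comm inside before) ⟩
    m ℕ.+ (before ℕ.+ inside)                                    ≡⟨ ℕ.+-assoc m before inside ⟨
    m ℕ.+ before ℕ.+ inside                                      ∎)
    where
    open ≡.≡-Reasoning
    inside = count (inside? s v) (neighbours v)
    before = count (before? v) (neighbours v)

-- Weights of intervals

lookup-⇔ : ∀ {n} {X Y : Subset n} {v} → (v ∈ X → v ∈ Y) → (v ∈ Y → v ∈ X) → Vec.lookup X v ≡ Vec.lookup Y v
lookup-⇔ {X = X} {Y} {v} to from with Vec.lookup X v in eq | Vec.lookup Y v in eq′
... | true  | true  = refl
... | false | false = refl
... | true  | false = ≡.trans (≡.sym (Vec.[]=⇒lookup (to (Vec.lookup⇒[]= v X eq)))) eq′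
... | false | true  = ≡.trans (≡.sym eq) (Vec.[]=⇒lookup (from (Vec.lookup⇒[]= v Y eq′)))

∉⇒lookup : ∀ {n} {X : Subset n} {v} → v ∉ X → Vec.lookup X v ≡ false
∉⇒lookup {X = X} {v} v∉X with Vec.lookup X v in eq
... | true  = contradiction (Vec.lookup⇒[]= v X eq) v∉X
... | false = refl

module WeightProperties {c ℓ₁ ℓ₂} (F : ArchimedeanOrderedField c ℓ₁ ℓ₂) where
  open ArchimedeanOrderedField F renaming (refl to ≈-refl; sym to ≈-sym; trans to ≈-trans)
  open OrderedFieldProperties F
  open MonoidSum +-monoid using (sum-cong-≋; sum-replicate-zero)
  open Weights F
  open PartialOrderReasoning poset

  sum-update : ∀ {m} (f g : Vector Carrier m) i {x} → (∀ j → j ≢ i → f j ≈ g j) → f i ≈ x + g i →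
               sum f ≈ x + sum g
  sum-update f g Fin.zero {x} f≈g fi≈ = begin-equality
    sum f                                                   ≈⟨ +-cong fi≈ (sum-cong-≋ λ j → f≈g (Fin.suc j) λ ()) ⟩
    x + g Fin.zero + sum (g ∘ Fin.suc)                      ≈⟨ +-assoc _ _ _ ⟩
    x + sum g                                               ∎
  sum-update f g (Fin.suc i) {x} f≈g fi≈ = begin-equality
    sum f
      ≈⟨ +-cong (f≈g Fin.zero λ ()) (sum-update (f ∘ Fin.suc) (g ∘ Fin.suc) i (λ j j≢i → f≈g (Fin.suc j) (j≢i ∘ Fin.suc-injective)) fi≈) ⟩
    g Fin.zero + (x + sum (g ∘ Fin.suc))                    ≈⟨ +-assoc _ _ _ ⟨
    g Fin.zero + x + sum (g ∘ Fin.suc)                      ≈⟨ +-congʳ (+-comm _ _) ⟩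
    x + g Fin.zero + sum (g ∘ Fin.suc)                      ≈⟨ +-assoc _ _ _ ⟩
    x + sum g                                               ∎

  sum-mono-≤ : ∀ {m} (f g : Vector Carrier m) → (∀ i → f i ≤ g i) → sum f ≤ sum g
  sum-mono-≤ {ℕ.zero}  f g f≤g = ≤-refl
  sum-mono-≤ {ℕ.suc m} f g f≤g = +-mono-≤ (f≤g Fin.zero) (sum-mono-≤ (f ∘ Fin.suc) (g ∘ Fin.suc) (f≤g ∘ Fin.suc))

  module _ {n} (w : Vector Carrier n) where

    weight-empty : ∀ s → weight w ⟦ ℕ.suc s , s ⟧ ≈ 0#
    weight-empty s = ≈-trans (sum-cong-≋ λ v → reflexive (cong (if_then w v else 0#) (∉⇒lookup {v = v} λ v∈ →
        ℕ.<⇒≱ (proj₁ (∈⟦⟧⁻ (ℕ.suc s) s v∈)) (proj₂ (∈⟦⟧⁻ (ℕ.suc s) s v∈)))))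
      (sum-replicate-zero n)

    weight-step : ∀ {s} (v : Fin n) → toℕ v ℕ.< s →
                  weight w ⟦ ℕ.suc (toℕ v) , s ⟧ ≈ w v + weight w ⟦ ℕ.suc (ℕ.suc (toℕ v)) , s ⟧
    weight-step {s} v v<s = sum-update _ _ v
      (λ u u≢v → reflexive (cong (if_then w u else 0#) (lookup-⇔ {X = X} {Y} (to u≢v) from)))
      (begin-equality
        (if Vec.lookup X v then w v else 0#)
          ≡⟨ cong (if_then w v else 0#) (Vec.[]=⇒lookup {xs = X} {i = v} (∈⟦⟧⁺ ℕ.≤-refl v<s)) ⟩
        w v                                        ≈⟨ +-identityʳ (w v) ⟨
        w v + 0#
          ≡⟨ cong (λ b → w v + (if b then w v else 0#)) (∉⇒lookup {X = Y} {v = v} v∉Y) ⟨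
        w v + (if Vec.lookup Y v then w v else 0#) ∎)
      where
      X = ⟦ ℕ.suc (toℕ v) , s ⟧
      Y = ⟦ ℕ.suc (ℕ.suc (toℕ v)) , s ⟧
      v∉Y : v ∉ Y
      v∉Y v∈Y = ℕ.<-irrefl refl (proj₁ (∈⟦⟧⁻ (ℕ.suc (ℕ.suc (toℕ v))) s v∈Y))
      to : ∀ {u} → u ≢ v → u ∈ X → u ∈ Y
      to u≢v u∈X with v≤u , u≤s ← ∈⟦⟧⁻ (ℕ.suc (toℕ v)) s u∈X =
        ∈⟦⟧⁺ (ℕ.s≤s (ℕ.≤∧≢⇒< (ℕ.s≤s⁻¹ v≤u) λ v≡u → u≢v (≡.sym (Fin.toℕ-injective v≡u)))) u≤s
      from : ∀ {u} → u ∈ Y → u ∈ X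
      from u∈Y with v<u , u≤s ← ∈⟦⟧⁻ (ℕ.suc (ℕ.suc (toℕ v))) s u∈Y = ∈⟦⟧⁺ (ℕ.<⇒≤ v<u) u≤s

    weight-mono-⊆ : (∀ v → 0# ≤ w v) → ∀ {X Y} → X ⊆ Y → weight w X ≤ weight w Y
    weight-mono-⊆ 0≤w {X} {Y} X⊆Y = sum-mono-≤ _ _ term
      where
      term : ∀ v → (if Vec.lookup X v then w v else 0#) ≤ (if Vec.lookup Y v then w v else 0#)
      term v with Vec.lookup X v in eq | Vec.lookup Y v in eq′
      ... | true  | true  = ≤-refl
      ... | false | false = ≤-refl
      ... | false | true  = 0≤w v
      ... | true  | false with () ← ≡.trans (≡.sym eq′) (Vec.[]=⇒lookup (X⊆Y (Vec.lookup⇒[]= v X eq)))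

    -- The program tests the deviation from A while balance is stated by two bounds; they agree
    -- because (1 ± ε)A = A ± εA.
    balanced⇒deviation : ∀ {k ε X} → Balanced w k ε X → ∣ weight w X - average w k ∣ ≤ ε * average w k
    balanced⇒deviation {k} {ε} (lower , upper) = ∣x-y∣≤z⁺
      (≤-trans (≤-reflexive (≈-sym ([1-x]*y≈y-x*y ε _))) lower) (≤-trans upper (≤-reflexive ([1+x]*y≈y+x*y ε _)))

    deviation⇒balanced : ∀ {k ε X} → ∣ weight w X - average w k ∣ ≤ ε * average w k → Balanced w k ε X
    deviation⇒balanced {k} {ε} p with lower , upper ← ∣x-y∣≤z⁻ p =
      ≤-trans (≤-reflexive ([1-x]*y≈y-x*y ε _)) lower , ≤-trans upper (≤-reflexive (≈-sym ([1+x]*y≈y+x*y ε _)))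

-- The scan finds a minimiser

module Scan {c ℓ₁ ℓ₂} (F : ArchimedeanOrderedField c ℓ₁ ℓ₂) {n : ℕ} (G : Graph n)
  (w : Vector (ArchimedeanOrderedField.Carrier F) n) (k : ℕ) (ε : ArchimedeanOrderedField.Carrier F) where

  open ArchimedeanOrderedField F renaming (refl to ≈-refl; sym to ≈-sym; trans to ≈-trans)
  open OrderedFieldProperties F
  open Graph G using (neighbours; δ)
  open Weights F
  open WeightProperties F
  open DynamicPartition F G w k ε
  open Subroutines F G w k ε

  verticesDownFrom-suc : ∀ v → verticesDownFrom (ℕ.suc (toℕ v)) ≡ v ∷ verticesDownFrom (toℕ v)
  verticesDownFrom-suc v = ≡.trans (cong reverse (List.take-suc-tabulate (λ u → u) v))
    (List.reverse-++ (take (toℕ v) (allFin n)) (v ∷ []))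

  down-verticesDownFrom : ∀ s → s ℕ.≤ n → Down s (verticesDownFrom s)
  down-verticesDownFrom ℕ.zero    _   = []
  down-verticesDownFrom (ℕ.suc s) s<n = subst (λ m → Down (ℕ.suc m) (verticesDownFrom (ℕ.suc m))) (Fin.toℕ-fromℕ< s<n)
    (subst (Down _) (≡.sym (verticesDownFrom-suc v))
      (v ∷ subst (λ m → Down m (verticesDownFrom m)) (≡.sym (Fin.toℕ-fromℕ< s<n)) (down-verticesDownFrom s (ℕ.<⇒≤ s<n))))
    where v = Fin.fromℕ< s<n

  avg : Carrier
  avg = average w k

  module _ (T : Tables) (s t : ℕ) where
    open Tables T using (cut)

    -- The scan invariant once the indices above j have been visited. `nothing` means that every
    -- admissible one had infinite objective, since infinite candidates are never stored.
    BestAbove : ℕ → Best → Set ℓ₂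
    BestAbove j nothing        = ∀ i → j ℕ.< i → Admissible T s i → objective T s t i ≡ ⊤⁺
    BestAbove j (just (x , r)) = Admissible T s r × objective T s t r ≡ [ x ] ×
                                 (∀ i → j ℕ.< i → Admissible T s i → [ x ] ≤⁺ objective T s t i)

    initial-best : BestAbove s nothing
    initial-best i s<i (_ , i≤s , _) = contradiction i≤s (ℕ.<⇒≱ s<i)

    weaken : ∀ {q} {Q : ℕ → Set q} {j} → (Admissible T s (ℕ.suc j) → Q (ℕ.suc j)) →
             (∀ i → ℕ.suc j ℕ.< i → Admissible T s i → Q i) → ∀ i → j ℕ.< i → Admissible T s i → Q i
    weaken here above i j<i adm with ℕ.m≤n⇒m<n∨m≡n j<i
    ... | inj₁ 1+j<i = above i 1+j<i adm
    ... | inj₂ refl  = here adm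

    skip-best : ∀ {j} best → ¬ Admissible T s (ℕ.suc j) → BestAbove (ℕ.suc j) best → BestAbove j best
    skip-best nothing        ¬adm above                 = weaken (λ adm → contradiction adm ¬adm) above
    skip-best (just (x , r)) ¬adm (admr , objr , above) = admr , objr , weaken (λ adm → contradiction adm ¬adm) above

    -- With no admissible index left at or below j, the invariant descends to 0 as if the scan had
    -- gone on.
    stop-best : ∀ {j} best → (∀ i → i ℕ.≤ j → ¬ Admissible T s i) → BestAbove j best → BestAbove 0 best
    stop-best {ℕ.zero}  best none above = above
    stop-best {ℕ.suc j} best none above =
      stop-best best (λ i i≤j → none i (ℕ.m≤n⇒m≤1+n i≤j)) (skip-best best (none _ ℕ.≤-refl) above)

    consider-best : ∀ {j} best c → Admissible T s (ℕ.suc j) → objective T s t (ℕ.suc j) ≡ c →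
                    BestAbove (ℕ.suc j) best → BestAbove j (value (consider (ℕ.suc j) c best))
    consider-best nothing        ⊤⁺    adm obj≡ above                 = weaken (λ _ → obj≡) above
    consider-best (just (y , r)) ⊤⁺    adm obj≡ (admr , objr , above) =
      admr , objr , weaken (λ _ → subst ([ y ] ≤⁺_) (≡.sym obj≡) (_ ≤⊤⁺)) above
    consider-best nothing        [ x ] adm obj≡ above                 =
      adm , obj≡ , weaken (λ _ → ≤⁺-reflexive-≡ ℕ.≤-reflexive (≡.sym obj≡))
                          (λ i 1+j<i admi → subst ([ x ] ≤⁺_) (≡.sym (above i 1+j<i admi)) (_ ≤⊤⁺))
    consider-best {j} (just (y , r)) [ x ] adm obj≡ (admr , objr , above) = if-elim (BestAbove j) (x ℕ.<? y)
      (λ x<y → adm , obj≡ , weaken (λ _ → ≤⁺-reflexive-≡ ℕ.≤-reflexive (≡.sym obj≡))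
                                   (λ i 1+j<i admi → ≤⁺-trans ℕ.≤-trans [ ℕ.<⇒≤ x<y ] (above i 1+j<i admi)))
      (λ x≮y → admr , objr , weaken (λ _ → subst ([ y ] ≤⁺_) (≡.sym obj≡) [ ℕ.≮⇒≥ x≮y ]) above)

    module _ (positive : Bool) (positive⇒0<w : positive ≡ true → ∀ v → 0# < w v) where

      -- Lowering the left end enlarges the interval, and with nonnegative weights its weight cannot
      -- fall back below the upper bound.
      exceeds⇒¬admissible : (∀ v → 0# ≤ w v) → ∀ {j} → (1# + ε) * avg < weight w ⟦ j , s ⟧ →
                            ∀ i → i ℕ.≤ j → ¬ Admissible T s i
      exceeds⇒¬admissible 0≤w {j} exceeds i i≤j (_ , _ , dev) = <⇒≱ exceeds
        (≤-trans (weight-mono-⊆ w 0≤w λ v∈ → let j≤v , v≤s = ∈⟦⟧⁻ j s v∈ in ∈⟦⟧⁺ (ℕ.≤-trans i≤j j≤v) v≤s)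
                 (proj₂ (deviation⇒balanced w {k} {ε} {⟦ i , s ⟧} dev)))

      -- The running σ matches the interval weight only up to the equality of the field, because
      -- `weight` sums over all vertices with zeros outside the interval. Both comparisons are
      -- therefore transported along that equality.
      scan-best : ∀ {j vs σ d} best → Down j vs → j ℕ.≤ s →
                  σ ≈ weight w ⟦ ℕ.suc j , s ⟧ → d ≡ δ ⟦ 1 , j ⟧ ⟦ ℕ.suc j , s ⟧ → BestAbove j best →
                  BestAbove 0 (value (scan avg (ε * avg) ((1# + ε) * avg) positive s t cut vs σ d best))
      scan-best best [] j≤s σ≈ d≡ above = above
      scan-best {σ = σ} {d} best (_∷_ v {vs} down) v<s σ≈ d≡ above = if-∧-elim (λ m → BestAbove 0 (value m))
        positive ((1# + ε) * avg <? w v + σ)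
        (λ pos exceeds → stop-best best
          (exceeds⇒¬admissible (λ u → proj₁ (positive⇒0<w pos u)) (exceeds′ exceeds)) above)
        (if-elim (λ m → BestAbove 0 (value m)) (∣ w v + σ - avg ∣ ≤? ε * avg)
          (λ dev → scan-best _ down (ℕ.<⇒≤ v<s) σ′≈ d′≡
            (consider-best best _ (ℕ.s≤s ℕ.z≤n , v<s , dev⁺ dev)
              (cong (λ d → Maybe.map (ℕ._+ d) (cut (toℕ v) (pred t))) (≡.sym d′≡)) above))
          (λ ¬dev → scan-best best down (ℕ.<⇒≤ v<s) σ′≈ d′≡
            (skip-best best (λ (_ , _ , dev) → ¬dev (dev⁻ dev)) above)))
        where
        W = weight w ⟦ ℕ.suc (toℕ v) , s ⟧
        σ′≈ : w v + σ ≈ W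
        σ′≈ = ≈-trans (+-congˡ σ≈) (≈-sym (weight-step w v v<s))
        d′≡ : value (updateδ s v (neighbours v) d) ≡ δ ⟦ 1 , toℕ v ⟧ ⟦ ℕ.suc (toℕ v) , s ⟧
        d′≡ = ≡.trans (cong (λ d → value (updateδ s v (neighbours v) d)) d≡) (updateδ-δ v v<s)
        dev⁺ : ∣ w v + σ - avg ∣ ≤ ε * avg → ∣ W - avg ∣ ≤ ε * avg
        dev⁺ = ≤-trans (≤-reflexive (∣∣-cong (+-congʳ (≈-sym σ′≈))))
        dev⁻ : ∣ W - avg ∣ ≤ ε * avg → ∣ w v + σ - avg ∣ ≤ ε * avg
        dev⁻ = ≤-trans (≤-reflexive (∣∣-cong (+-congʳ σ′≈)))
        exceeds′ : (1# + ε) * avg < w v + σ → (1# + ε) * avg < W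
        exceeds′ (le , neq) = ≤-trans le (≤-reflexive σ′≈) , λ eq → neq (≈-trans eq (≈-sym σ′≈))

-- The tables satisfy the recurrence

cutEdges-[] : ∀ {n} E → cutEdges {n} E [] ≡ 0
cutEdges-[] []      = refl
cutEdges-[] (_ ∷ E) = cutEdges-[] E

module Recurrence {c ℓ₁ ℓ₂} (F : ArchimedeanOrderedField c ℓ₁ ℓ₂) {n : ℕ} (G : Graph n)
  (w : Vector (ArchimedeanOrderedField.Carrier F) n) (k : ℕ) (ε : ArchimedeanOrderedField.Carrier F) where

  open ArchimedeanOrderedField F using (_-_; _*_; _+_; ∣_∣; _≤_; 0#; 1#; _<_; _·_; _⁻¹)
  open Graph G using (edgesWithin; δ; edges)
  open CutProperties G
  open Weights F
  open DynamicPartition F G w k ε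
  open Subroutines F G w k ε
  open Scan F G w k ε
  open Tables

  Fits : ℕ → ℕ → Set ℓ₂
  Fits s j = ∣ weight w ⟦ j , s ⟧ - avg ∣ ≤ ε * avg

  open Intervals n Fits using (Blocks; []; _∷_; blocks-partition; blocks-≤)

  cost : ℕ → List (ℕ × ℕ) → ℕ
  cost s bs = cutEdges (edgesWithin ⟦ 1 , s ⟧) (map ⟦_⟧ bs)

  cost-[] : ∀ s → cost s [] ≡ 0
  cost-[] s = cutEdges-[] (edgesWithin ⟦ 1 , s ⟧)

  cost-∷ : ∀ {r s t bs} → r ℕ.≤ s → Blocks r t bs →
           cost s ((ℕ.suc r , s) ∷ bs) ≡ cost r bs ℕ.+ δ ⟦ 1 , r ⟧ ⟦ ℕ.suc r , s ⟧
  cost-∷ {r} {s} r≤s b = cutEdges-∷ {r} {s} r≤s (blocks-partition b)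

  -- R is the set of entries computed so far.
  record FilledOn (R : ℕ → ℕ → Set) (T : Tables) : Set ℓ₂ where
    field
      cut-0-0   : cut T 0 0 ≡ [ 0 ]
      parts-0-0 : parts T 0 0 ≡ []
      initial   : ∀ s t → ¬ R s t → (s , t) ≢ (0 , 0) → parts T s t ≡ [] × cut T s t ≡ ⊤⁺
      entries   : ∀ s t → R s t → IsEntry T s t

  open FilledOn

  filledOn-cong : ∀ {R R′ T} → (∀ {s t} → R s t → R′ s t) → (∀ {s t} → R′ s t → R s t) →
                  FilledOn R T → FilledOn R′ T
  filledOn-cong R⇒R′ R′⇒R filled = record
    { cut-0-0   = cut-0-0 filled
    ; parts-0-0 = parts-0-0 filled
    ; initial   = λ s t ¬R′ → initial filled s t (¬R′ ∘ R⇒R′)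
    ; entries   = λ s t → entries filled s t ∘ R′⇒R
    }

  -- An entry is either untouched or a genuine sequence of fitting blocks with its true number of
  -- cut edges. This is meant for all indices, including those outside the loop range.
  Sound : Tables → ℕ → ℕ → Set ℓ₂
  Sound T s t = (parts T s t ≡ [] × cut T s t ≡ ⊤⁺) ⊎
                (Blocks s t (parts T s t) × cut T s t ≡ [ cost s (parts T s t) ])

  objective-finite : ∀ T r s t → objective T s (ℕ.suc t) (ℕ.suc r) ≢ ⊤⁺ → Sound T r t →
                     Blocks r t (parts T r t) × cut T r t ≡ [ cost r (parts T r t) ]
  objective-finite T _ _ _ obj≢⊤ (inj₁ (_ , cut≡)) = contradiction (cong (Maybe.map _) cut≡) obj≢⊤
  objective-finite T _ _ _ obj≢⊤ (inj₂ sound)      = sound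

  -- Induction on t, as a finite entry of column t + 1 refers only to column t. Entries outside R
  -- have their initial values, and of these only (0,0) is finite; it stands for the empty sequence.
  sound : ∀ {R T} → (∀ s t → Dec (R s t)) → (∀ {s t} → R s t → InLoopRange s t) → FilledOn R T →
          ∀ s t → Sound T s t
  sound {R} {T} R? R⇒ filled s t with R? s t
  sound R? R⇒ filled ℕ.zero ℕ.zero | no ¬R rewrite parts-0-0 filled =
    inj₂ ([] , ≡.trans (cut-0-0 filled) (cong [_] (≡.sym (cost-[] 0))))
  sound R? R⇒ filled (ℕ.suc s) ℕ.zero | no ¬R = inj₁ (initial filled _ _ ¬R λ ())
  sound R? R⇒ filled s (ℕ.suc t) | no ¬R = inj₁ (initial filled _ _ ¬R λ ())
  sound R? R⇒ filled s ℕ.zero | yes Rst with () ← proj₁ (R⇒ Rst)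
  sound {R} {T} R? R⇒ filled s (ℕ.suc t) | yes Rst with entries filled s (ℕ.suc t) Rst
  ... | infinite _ parts≡ cut≡ = inj₁ (parts≡ , cut≡)
  ... | finite (ℕ.suc r) ((_ , r<s , fits) , _) obj≢⊤ parts≡ cut≡ =
    inj₂ (subst (Blocks s (ℕ.suc t)) (≡.sym parts≡)
      ((r<s , fits) ∷ proj₁ (objective-finite T r s t obj≢⊤ (sound R? R⇒ filled r t))) , cut≡)

  -- The condition on entry (s,t) reads that entry and column `pred t` only, so it survives writes
  -- elsewhere.
  isEntry-cong : ∀ {T T′ s t} →
                 parts T s t ≡ parts T′ s t → cut T s t ≡ cut T′ s t →
                 (∀ r → parts T r (pred t) ≡ parts T′ r (pred t)) → (∀ r → cut T r (pred t) ≡ cut T′ r (pred t)) →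
                 IsEntry T s t → IsEntry T′ s t
  isEntry-cong {T} {T′} {s} {t} parts≡ cut≡ partsPred cutPred = λ where
      (infinite all⊤ p c) → infinite (λ j adm → ≡.trans (≡.sym (obj≡ j)) (all⊤ j adm))
        (≡.trans (≡.sym parts≡) p) (≡.trans (≡.sym cut≡) c)
      (finite r (adm , min) obj≢ p c) → finite r
        (adm , λ j admj → ≡.subst₂ _≤⁺_ (obj≡ r) (obj≡ j) (min j admj))
        (λ obj≡⊤ → obj≢ (≡.trans (obj≡ r) obj≡⊤))
        (≡.trans (≡.sym parts≡) (≡.trans p (cong ((r , s) ∷_) (partsPred (pred r)))))
        (≡.trans (≡.sym cut≡) (≡.trans c (cong (λ bs → [ cost s bs ]) parts≡)))
    where
    obj≡ : ∀ j → objective T s t j ≡ objective T′ s t j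
    obj≡ j = cong (Maybe.map _) (cutPred (pred j))

  InLoopRange? : ∀ s t → Dec (InLoopRange s t)
  InLoopRange? s t = (1 ℕ.≤? t) ×-dec (t ℕ.≤? k) ×-dec (t ℕ.≤? s) ×-dec (s ℕ.+ k ℕ.≤? n ℕ.+ t)

  -- The entries finished when the outer loop stands at t and the inner loop at s: earlier columns,
  -- and earlier rows of column t.
  Done : ℕ → ℕ → ℕ → ℕ → Set
  Done t s s′ t′ = InLoopRange s′ t′ × (t′ ℕ.< t ⊎ (t′ ≡ t × s′ ℕ.< s))

  done? : ∀ t s s′ t′ → Dec (Done t s s′ t′)
  done? t s s′ t′ = InLoopRange? s′ t′ ×-dec ((t′ ℕ.<? t) ⊎-dec ((t′ ℕ.≟ t) ×-dec (s′ ℕ.<? s)))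

  initialTables : Tables
  initialTables = tables (λ _ _ → []) (value (write (λ _ _ → ⊤⁺) 0 0 [ 0 ]))

  module _ (positive : Bool) (positive⇒0<w : positive ≡ true → ∀ v → 0# < w v) where

    entry′ : ℕ → ℕ → Tables → Timed Tables
    entry′ = entry avg (ε * avg) ((1# + ε) * avg) positive

    update′ : ℕ → ℕ → Tables → Best → Timed Tables
    update′ = update avg (ε * avg) ((1# + ε) * avg) positive

    entry-best : ∀ {s} t T → s ℕ.≤ n → BestAbove T s t 0
      (value (scan avg (ε * avg) ((1# + ε) * avg) positive s t (cut T) (verticesDownFrom s) 0# 0 nothing))
    entry-best {s} t T s≤n = scan-best T s t positive positive⇒0<w nothing (down-verticesDownFrom s s≤n) ℕ.≤-refl
      (≈-sym (weight-empty w s)) (≡.sym δ≡0) (initial-best T s t)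
      where
      open ArchimedeanOrderedField F using () renaming (sym to ≈-sym)
      open WeightProperties F
      δ≡0 : δ ⟦ 1 , s ⟧ ⟦ ℕ.suc s , s ⟧ ≡ 0
      δ≡0 = cong length (List.filter-none _ (All.universal (λ (u , v) → λ
        { (inj₁ (_ , v∈)) → absurd v∈ ; (inj₂ (u∈ , _)) → absurd u∈ }) edges))
        where
        absurd : ∀ {v} → v ∈ ⟦ ℕ.suc s , s ⟧ → ⊥
        absurd v∈ with s<v , v≤s ← ∈⟦⟧⁻ (ℕ.suc s) s v∈ = ℕ.<⇒≱ s<v v≤s

    -- A write at (s,t) leaves intact the finished entries and the columns that they read, and also
    -- column `pred t`, from which the new entry is formed. If the scan found nothing, the entry
    -- keeps its initial value, as the recurrence demands.
    update-filled : ∀ {s t T} best → InLoopRange s t → BestAbove T s t 0 best →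
                    FilledOn (Done t s) T → FilledOn (Done t (ℕ.suc s)) (value (update′ s t T best))
    update-filled {s} {t} {T} best range@(1≤t , t≤k , t≤s , s+k≤n+t) best≡ filled = helper best best≡
      where
      now : ¬ Done t s s t
      now (_ , inj₁ t<t)       = ℕ.<-irrefl refl t<t
      now (_ , inj₂ (_ , s<s)) = ℕ.<-irrefl refl s<s

      st≢00 : (s , t) ≢ (0 , 0)
      st≢00 refl = contradiction 1≤t λ ()

      widen : ∀ {s′ t′} → Done t s s′ t′ → Done t (ℕ.suc s) s′ t′
      widen (range′ , inj₁ lt)         = range′ , inj₁ lt
      widen (range′ , inj₂ (eq , s′<s)) = range′ , inj₂ (eq , ℕ.m≤n⇒m≤1+n s′<s)

      narrow : ∀ {s′ t′} → Done t (ℕ.suc s) s′ t′ → Done t s s′ t′ ⊎ (s′ , t′) ≡ (s , t)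
      narrow (range′ , inj₁ lt) = inj₁ (range′ , inj₁ lt)
      narrow (range′ , inj₂ (refl , s′<1+s)) with ℕ.m≤n⇒m<n∨m≡n (ℕ.s≤s⁻¹ s′<1+s)
      ... | inj₁ s′<s = inj₁ (range′ , inj₂ (refl , s′<s))
      ... | inj₂ refl = inj₂ refl

      helper : ∀ best → BestAbove T s t 0 best → FilledOn (Done t (ℕ.suc s)) (value (update′ s t T best))
      helper nothing all⊤ = record
        { cut-0-0   = cut-0-0 filled
        ; parts-0-0 = parts-0-0 filled
        ; initial   = λ s′ t′ ¬done → initial filled s′ t′ (¬done ∘ widen)
        ; entries   = λ s′ t′ done → Sum.[ entries filled s′ t′ , (λ { refl → new }) ] (narrow done)
        }
        where
        new : IsEntry T s t
        new = let p , c = initial filled s t now st≢00 in infinite (λ j adm → all⊤ j (proj₁ adm) adm) p c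
      helper (just (x , ℕ.suc r)) (adm@(_ , r<s , fits) , obj≡ , min) = record
        { cut-0-0   = ≡.trans (cut-other (st≢00 ∘ ≡.sym)) (cut-0-0 filled)
        ; parts-0-0 = ≡.trans (parts-other (st≢00 ∘ ≡.sym)) (parts-0-0 filled)
        ; initial   = λ s′ t′ ¬done ≢00 →
            let neq = λ { refl → ¬done (range , inj₂ (refl , ℕ.≤-refl)) }
                p , c = initial filled s′ t′ (¬done ∘ widen) ≢00
            in ≡.trans (parts-other neq) p , ≡.trans (cut-other neq) c
        ; entries   = λ s′ t′ done → Sum.[ old , (λ { refl → new }) ] (narrow done)
        }
        where
        T′ : Tables
        T′ = value (update′ s t T (just (x , ℕ.suc r)))
        cut-other : ∀ {s′ t′} → (s′ , t′) ≢ (s , t) → cut T′ s′ t′ ≡ cut T s′ t′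
        cut-other = read-write-other (cut T) s t [ x ]
        parts-other : ∀ {s′ t′} → (s′ , t′) ≢ (s , t) → parts T′ s′ t′ ≡ parts T s′ t′
        parts-other = read-write-other (parts T) s t _
        old : ∀ {s′ t′} → Done t s s′ t′ → IsEntry T′ s′ t′
        old {s′} {t′} done@((1≤t′ , _) , before) = isEntry-cong
          (≡.sym (parts-other other)) (≡.sym (cut-other other))
          (λ r → ≡.sym (parts-other pred-other)) (λ r → ≡.sym (cut-other pred-other))
          (entries filled s′ t′ done)
          where
          other : (s′ , t′) ≢ (s , t)
          other refl = now done
          t′≤t : t′ ℕ.≤ t
          t′≤t = Sum.[ ℕ.<⇒≤ , (λ (eq , _) → ℕ.≤-reflexive eq) ] before
          -- The columns differ since `pred t′` < t′ ≤ t; the first inequality needs 1 ≤ t′ because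
          -- `pred` fixes 0.
          pred-other : ∀ {r} → (r , pred t′) ≢ (s , t)
          pred-other eq = ℕ.<⇒≢ (ℕ.<-≤-trans (ℕ.≤-reflexive (ℕ.suc-pred t′ {{ℕ.>-nonZero 1≤t′}})) t′≤t) (cong proj₂ eq)
        new : IsEntry T′ s t
        new = finite (ℕ.suc r)
          (adm , λ j admj → ≡.subst₂ _≤⁺_
            (≡.sym (≡.trans (objective≡ (ℕ.suc r)) obj≡)) (≡.sym (objective≡ j)) (min j (proj₁ admj) admj))
          (λ obj≡⊤ → contradiction (≡.trans (≡.sym obj≡) (≡.trans (≡.sym (objective≡ (ℕ.suc r))) obj≡⊤)) λ ())
          (≡.trans parts≡ (cong ((ℕ.suc r , s) ∷_) (≡.sym (parts-other pred≢))))
          (≡.trans (read-write-same (cut T) s t [ x ]) (cong [_] x≡cost))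
          where
          pred≢ : ∀ {r} → (r , pred t) ≢ (s , t)
          pred≢ eq = ℕ.<⇒≢ (ℕ.≤-reflexive (ℕ.suc-pred t {{ℕ.>-nonZero 1≤t}})) (cong proj₂ eq)
          objective≡ : ∀ j → objective T′ s t j ≡ objective T s t j
          objective≡ j = cong (Maybe.map _) (cut-other pred≢)
          bs : List (ℕ × ℕ)
          bs = parts T r (pred t)
          parts≡ : parts T′ s t ≡ (ℕ.suc r , s) ∷ bs
          parts≡ = read-write-same (parts T) s t _
          sound-r : Blocks r (pred t) bs × cut T r (pred t) ≡ [ cost r bs ]
          sound-r = objective-finite T r s (pred t) (λ obj≡⊤ → contradiction (≡.trans (≡.sym obj≡) obj≡⊤) λ ())
            (sound (done? t s) proj₁ filled r (pred t))
          -- Here the stored minimum meets the recount of step (iii): soundness of entry (r,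
          -- `pred t`) turns its number into a cost, and `cost-∷` adds the edges into the new block.
          x≡cost : x ≡ cost s (parts T′ s t)
          x≡cost = begin
            x
              ≡⟨ Maybe.just-injective (≡.trans (≡.sym obj≡) (cong (Maybe.map _) (proj₂ sound-r))) ⟩
            cost r bs ℕ.+ δ ⟦ 1 , r ⟧ ⟦ ℕ.suc r , s ⟧      ≡⟨ cost-∷ {r} {s} (ℕ.<⇒≤ r<s) (proj₁ sound-r) ⟨
            cost s ((ℕ.suc r , s) ∷ bs)                    ≡⟨ cong (cost s) parts≡ ⟨
            cost s (parts T′ s t)                          ∎
            where open ≡.≡-Reasoning

    in-range : ∀ {s t} → 1 ℕ.≤ t → t ℕ.≤ k → t ℕ.≤ s → s ℕ.≤ (n ℕ.+ t) ℕ.∸ k → InLoopRange s t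
    in-range {s} {t} 1≤t t≤k t≤s s≤hi with ℕ.≤-total k (n ℕ.+ t)
    ... | inj₁ k≤n+t = 1≤t , t≤k , t≤s , ℕ.m≤o∸n⇒m+n≤o s k≤n+t s≤hi
    ... | inj₂ n+t≤k = contradiction (ℕ.≤-trans t≤s s≤hi) (ℕ.<⇒≱ (subst (ℕ._< t) (≡.sym (ℕ.m≤n⇒m∸n≡0 n+t≤k)) 1≤t))

    range⇒≤n : ∀ {s t} → InLoopRange s t → s ℕ.≤ n
    range⇒≤n {s} {t} (_ , t≤k , _ , s+k≤n+t) = ℕ.+-cancelʳ-≤ k s n (ℕ.≤-trans s+k≤n+t (ℕ.+-monoʳ-≤ n t≤k))

    column : ℕ → Tables → Timed Tables
    column t = for t ((n ℕ.+ t) ℕ.∸ k) (entry′ t)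

    -- The end of column t is the start of column t + 1 at row t + 1, because the loop range
    -- requires t′ ≤ s′ and so has nothing in column t + 1 above that row.
    column-filled : ∀ {t T} → 1 ℕ.≤ t → t ℕ.≤ k → FilledOn (Done t t) T →
                    FilledOn (Done (ℕ.suc t) (ℕ.suc t)) (value (column t T))
    column-filled {t} {T} 1≤t t≤k filled = filledOn-cong to from
      (for-value t hi (entry′ t) (λ s → FilledOn (Done t s))
        (λ s T t≤s s≤hi → let range = in-range 1≤t t≤k t≤s s≤hi in
          update-filled _ range (entry-best t T (range⇒≤n range)))
        T filled)
      where
      hi = (n ℕ.+ t) ℕ.∸ k
      to : ∀ {s′ t′} → Done t (t ℕ.⊔ ℕ.suc hi) s′ t′ → Done (ℕ.suc t) (ℕ.suc t) s′ t′
      to (range , inj₁ t′<t)       = range , inj₁ (ℕ.m≤n⇒m≤1+n t′<t)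
      to (range , inj₂ (refl , _)) = range , inj₁ ℕ.≤-refl
      from : ∀ {s′ t′} → Done (ℕ.suc t) (ℕ.suc t) s′ t′ → Done t (t ℕ.⊔ ℕ.suc hi) s′ t′
      from (range@(_ , _ , t′≤s′ , _) , inj₂ (refl , s′<t′)) = contradiction t′≤s′ (ℕ.<⇒≱ s′<t′)
      from {s′} (range@(_ , _ , _ , s′+k≤) , inj₁ t′<1+t) with ℕ.m≤n⇒m<n∨m≡n (ℕ.s≤s⁻¹ t′<1+t)
      ... | inj₁ t′<t = range , inj₁ t′<t
      ... | inj₂ refl = range , inj₂ (refl , ℕ.≤-trans (ℕ.s≤s (ℕ.m+n≤o⇒m≤o∸n s′ s′+k≤)) (ℕ.m≤n⊔m t (ℕ.suc hi)))

    loop-filled : FilledOn InLoopRange (value (for 1 k column initialTables))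
    loop-filled = filledOn-cong proj₁ (λ range@(_ , t≤k , _) → range , inj₁ (ℕ.s≤s t≤k))
      (for-value 1 k column (λ t → FilledOn (Done t t))
        (λ t T 1≤t t≤k → column-filled 1≤t t≤k) initialTables initially)
      where
      initially : FilledOn (Done 1 1) initialTables
      initially = record
        { cut-0-0   = refl
        ; parts-0-0 = refl
        ; initial   = λ s t _ neq → refl , read-write-other (λ _ _ → ⊤⁺) 0 0 [ 0 ] neq
        ; entries   = λ { s t ((1≤t , _) , inj₁ t<1) → contradiction 1≤t (ℕ.<⇒≱ t<1)
                        ; s t ((_ , _ , t≤s , _) , inj₂ (refl , s<1)) → contradiction t≤s (ℕ.<⇒≱ s<1) }
        }

  fillTables-filled : FilledOn InLoopRange (value fillTables)
  fillTables-filled = subst (λ W → FilledOn InLoopRange (value (run (ι⁻¹ * W)))) (≡.sym (totalWeight-value (λ v → v)))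
    (loop-filled positive (allPositive-value⁻ (λ v → v)))
    where
    ι⁻¹ = (k · 1#) ⁻¹
    positive = value (allPositive (allFin n))
    run : _ → Timed Tables
    run avg = for 1 k (λ t → for t ((n ℕ.+ t) ℕ.∸ k) (entry avg (ε * avg) ((1# + ε) * avg) positive t)) initialTables

  satisfiesRecurrence : SatisfiesRecurrence (value fillTables)
  satisfiesRecurrence = record
    { cut-0-0   = cut-0-0 fillTables-filled
    ; parts-0-0 = parts-0-0 fillTables-filled
    ; initial   = initial fillTables-filled
    ; entries   = entries fillTables-filled
    }

-- Optimality of the output

module Optimality {c ℓ₁ ℓ₂} (F : ArchimedeanOrderedField c ℓ₁ ℓ₂) {n : ℕ} (G : Graph n)
  (w : Vector (ArchimedeanOrderedField.Carrier F) n) (k : ℕ) (ε : ArchimedeanOrderedField.Carrier F) where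

  open Graph G using (δ; edges; Connected; OrderingIsHamiltonianPath)
  open CutProperties G
  open Weights F
  open WeightProperties F
  open DynamicPartition F G w k ε
  open Recurrence F G w k ε
  open Tables
  open FilledOn fillTables-filled
  open Intervals n Fits hiding (parts)

  T : Tables
  T = value fillTables

  sound-fillTables : ∀ s t → Sound T s t
  sound-fillTables = sound InLoopRange? (λ range → range) fillTables-filled

  -- Induction on the competing sequence: its prefix makes the candidate r + 1 finite and no dearer
  -- than the competitor, and the entry minimises over all candidates. The bound s + k ≤ n + t keeps
  -- the indices within the loop range; it passes to the prefix because blocks are nonempty, r < s.
  optimal : ∀ {s t bs} → Blocks s t bs → t ℕ.≤ k → s ℕ.+ k ℕ.≤ n ℕ.+ t →
            ∃[ c ] cut T s t ≡ [ c ] × c ℕ.≤ cost s bs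
  optimal [] _ _ = 0 , cut-0-0 , ℕ.z≤n
  optimal (_∷_ {r} {s} {t} {bs} (r<s , fits) b) t<k s+k≤n+1+t
    with c′ , cut≡ , c′≤ ← optimal b (ℕ.<⇒≤ t<k)
           (ℕ.s≤s⁻¹ (ℕ.≤-trans (ℕ.+-monoˡ-≤ k r<s) (ℕ.≤-trans s+k≤n+1+t (ℕ.≤-reflexive (ℕ.+-suc n t)))))
    with entries s (ℕ.suc t) (ℕ.s≤s ℕ.z≤n , t<k , ℕ.≤-<-trans (blocks-≤ b) r<s , s+k≤n+1+t)
  ... | infinite all⊤ _ _ with () ← ≡.trans (≡.sym (all⊤ (ℕ.suc r) (ℕ.s≤s ℕ.z≤n , r<s , fits))) (cong (Maybe.map _) cut≡)
  ... | finite (ℕ.suc r′) ((_ , r′<s , _) , min) obj≢⊤ parts≡ cut≡′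
      with b′ , cut≡″ ← objective-finite T r′ s t obj≢⊤ (sound-fillTables r′ t)
      = _ , cut≡′ , (begin
        cost s (parts T s (ℕ.suc t))                               ≡⟨ cong (cost s) parts≡ ⟩
        cost s ((ℕ.suc r′ , s) ∷ parts T r′ t)                     ≡⟨ cost-∷ {r′} {s} (ℕ.<⇒≤ r′<s) b′ ⟩
        cost r′ (parts T r′ t) ℕ.+ δ ⟦ 1 , r′ ⟧ ⟦ ℕ.suc r′ , s ⟧   ≤⟨ [≤]-injective compare ⟩
        c′ ℕ.+ δ ⟦ 1 , r ⟧ ⟦ ℕ.suc r , s ⟧                         ≤⟨ ℕ.+-monoˡ-≤ _ c′≤ ⟩
        cost r bs ℕ.+ δ ⟦ 1 , r ⟧ ⟦ ℕ.suc r , s ⟧                  ≡⟨ cost-∷ {r} {s} (ℕ.<⇒≤ r<s) b ⟨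
        cost s ((ℕ.suc r , s) ∷ bs)                                ∎)
    where
    open ℕ.≤-Reasoning
    compare : [ cost r′ (parts T r′ t) ℕ.+ δ ⟦ 1 , r′ ⟧ ⟦ ℕ.suc r′ , s ⟧ ] ≤⁺ [ c′ ℕ.+ δ ⟦ 1 , r ⟧ ⟦ ℕ.suc r , s ⟧ ]
    compare = ≡.subst₂ _≤⁺_ (cong (Maybe.map _) cut≡″) (cong (Maybe.map _) cut≡)
      (min (ℕ.suc r) (ℕ.s≤s ℕ.z≤n , r<s , fits))

  cost-reverse : ∀ {t bs} → Blocks n t bs → cutEdges edges (map ⟦_⟧ (reverse bs)) ≡ cost n bs
  cost-reverse {bs = bs} b = ≡.trans (cutEdges-reverse b edges) (≡.sym (cutEdges-all (map ⟦_⟧ bs)))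

  partition⇒blocks : ∀ {P} → IsBalancedConsistentPartition w k ε P →
                     ∃[ bs ] Blocks n k bs × cutEdges edges P ≡ cost n bs
  partition⇒blocks {P} isP =
    let bs , chain , parts≡ = partition⇒chain {Good = Balanced w k ε}
          (λ {r} {s} → balanced⇒deviation w {k} {ε} {⟦ r , s ⟧})
          P ℕ.z≤n nonempty consistent balanced (λ _ _ → ℕ.z≤n) (λ v _ → IsPartition.covers isPartition v)
        blocks = subst (λ t → Blocks n t (reverse bs)) (≡.trans (ℕ.+-identityʳ (length P)) size) (chain⇒blocks chain [])
    in reverse bs , blocks , ≡.trans (cong (cutEdges edges)
         (≡.trans (≡.sym parts≡) (cong (map ⟦_⟧) (≡.sym (List.reverse-involutive bs))))) (cost-reverse blocks)
    where
    open IsBalancedConsistentPartition isP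
    open IsPartition isPartition using (nonempty)

  module _ (exists : ∃[ P ] IsBalancedConsistentPartition w k ε P) where

    -- A balanced partition yields a competitor at (n,k), so by `optimal` that entry is finite;
    -- soundness then supplies the blocks.
    stored : Blocks n k (parts T n k) × cut T n k ≡ [ cost n (parts T n k) ]
    stored with b ← partition⇒blocks (proj₂ exists) | sound-fillTables n k
    ... | inj₂ found = found
    ... | inj₁ (_ , cut≡⊤) with c , cut≡ , _ ← optimal (proj₁ (proj₂ b)) ℕ.≤-refl ℕ.≤-refl
        with () ← ≡.trans (≡.sym cut≡) cut≡⊤

    chain : Chain 0 (k ℕ.+ 0) (value dynamicPartition)
    chain = blocks⇒chain (proj₁ stored) []

    output-balanced : IsBalancedConsistentPartition w k ε output
    output-balanced = record
      { isPartition = chain-isPartition chain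
      ; size        = ≡.trans (List.length-map ⟦_⟧ (value dynamicPartition)) (≡.trans (chain-length chain) (ℕ.+-identityʳ k))
      ; consistent  = chain-consistent chain
      ; balanced    = λ i → let r , s , fits , eq = chain-lookup chain i in
          subst (Balanced w k ε) (≡.sym eq) (deviation⇒balanced w {k} {ε} {⟦ r , s ⟧} fits)
      }

    output-minimal : ∀ P → IsBalancedConsistentPartition w k ε P → cutEdges edges output ℕ.≤ cutEdges edges P
    output-minimal P isP =
      let bs , blocks , cut≡cost = partition⇒blocks isP
          c , cut≡ , c≤ = optimal blocks ℕ.≤-refl ℕ.≤-refl
      in begin
        cutEdges edges output     ≡⟨ cost-reverse (proj₁ stored) ⟩
        cost n (parts T n k)      ≡⟨ Maybe.just-injective (≡.trans (≡.sym (proj₂ stored)) cut≡) ⟩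
        c                         ≤⟨ c≤ ⟩
        cost n bs                 ≡⟨ cut≡cost ⟨
        cutEdges edges P          ∎
      where open ℕ.≤-Reasoning

    output-connected : OrderingIsHamiltonianPath → ∀ i → Connected (lookup output i)
    output-connected path i = let r , s , _ , eq = chain-lookup chain i in
      subst (λ X → Connected X) (≡.sym eq) (interval-connected path r s)

-- Counting elementary operations

sum-map-take : (f : A → ℕ) → ∀ s xs → ListAction.sum (map f (take s xs)) ℕ.≤ ListAction.sum (map f xs)
sum-map-take f ℕ.zero    xs       = ℕ.z≤n
sum-map-take f (ℕ.suc s) []       = ℕ.z≤n
sum-map-take f (ℕ.suc s) (x ∷ xs) = ℕ.+-monoʳ-≤ (f x) (sum-map-take f s xs)

module RunningTime {c ℓ₁ ℓ₂} (F : ArchimedeanOrderedField c ℓ₁ ℓ₂) {n : ℕ} (G : Graph n)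
  (w : Vector (ArchimedeanOrderedField.Carrier F) n) (k : ℕ) (ε : ArchimedeanOrderedField.Carrier F) where

  open ArchimedeanOrderedField F using (Carrier; _-_; _*_; _+_; ∣_∣; _≤_; _≤?_; _<?_; 0#; 1#; _<_; _·_; _⁻¹)
  open OrderedFieldProperties F
  open Graph G using (degree; neighbours; ∣E∣)
  open GraphProperties G using (sum-degree)
  open Weights F
  open DynamicPartition F G w k ε
  open Subroutines F G w k ε
  open Recurrence F G w k ε using (initialTables)
  open Tables

  -- Per neighbour at most four operations: a tick, two tests and one change of d. The end of the
  -- list costs one more.
  updateδ-steps : ∀ s v us d → steps (updateδ s v us d) ℕ.≤ 1 ℕ.+ 4 ℕ.* length us
  updateδ-steps s v []       d = ℕ.≤-refl
  updateδ-steps s v (u ∷ us) d = ℕ.≤-trans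
    (ℕ.+-monoʳ-≤ 2 (if-elim (λ m → steps m ℕ.≤ 3 ℕ.+ 4 ℕ.* length us) (u Fin.<? v)
      (λ _ → ℕ.m≤n⇒m≤1+n (ℕ.s≤s (updateδ-steps s v us (ℕ.suc d))))
      (λ _ → ℕ.s≤s (if-elim (λ m → steps m ℕ.≤ 2 ℕ.+ 4 ℕ.* length us) (ℕ.suc (toℕ u) ℕ.≤? s)
        (λ _ → ℕ.s≤s (updateδ-steps s v us (pred d)))
        (λ _ → ℕ.m≤n⇒m≤1+n (updateδ-steps s v us d))))))
    (ℕ.≤-reflexive (arithmetic (length us)))
    where
    arithmetic : ∀ l → 2 ℕ.+ (3 ℕ.+ 4 ℕ.* l) ≡ 1 ℕ.+ 4 ℕ.* ℕ.suc l
    arithmetic = solve-∀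

  consider-steps : ∀ j c best → steps (consider j c best) ≡ 1
  consider-steps j ⊤⁺    best             = refl
  consider-steps j [ x ] nothing          = refl
  consider-steps j [ x ] (just (y , r)) = refl

  update-steps : ∀ A εA upper positive s t T best → steps (update A εA upper positive s t T best) ℕ.≤ 4
  update-steps A εA upper positive s t T nothing        = ℕ.s≤s ℕ.z≤n
  update-steps A εA upper positive s t T (just (x , r)) = ℕ.≤-refl

  module _ (A εA upper : Carrier) (positive : Bool) (s t : ℕ) (cut : Array (ℕ ⁺)) where

    -- The 11 is 4 up to the stopping test, 1 for the end of `updateδ`, 3 up to the admissibility
    -- test, and 3 to read, form and consider a candidate. The bound b on the rest is left open so
    -- that full scans and scans stopped early can both use it.
    scan-∷-steps : ∀ v vs σ d best {b} →
                   (∀ d best → steps (scan A εA upper positive s t cut vs (w v + σ) d best) ℕ.≤ b) →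
                   steps (scan A εA upper positive s t cut (v ∷ vs) σ d best) ℕ.≤ 11 ℕ.+ 4 ℕ.* degree v ℕ.+ b
    scan-∷-steps v vs σ d best {b} rest = ℕ.+-monoʳ-≤ 4 (if-∧-elim (λ m → steps m ℕ.≤ 7 ℕ.+ 4 ℕ.* degree v ℕ.+ b)
      positive (upper <? w v + σ) (λ _ _ → ℕ.z≤n)
      (ℕ.≤-trans
        (ℕ.+-mono-≤ (updateδ-steps s v (neighbours v) d)
          (ℕ.+-monoʳ-≤ 3 (if-elim (λ m → steps m ℕ.≤ 3 ℕ.+ b) (∣ w v + σ - A ∣ ≤? εA)
            (λ _ → ℕ.+-monoʳ-≤ 2 (ℕ.+-mono-≤ (ℕ.≤-reflexive (consider-steps _ (Maybe.map _ (cut (toℕ v) (pred t))) best)) (rest _ _)))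
            (λ _ → ℕ.≤-trans (rest _ _) (ℕ.m≤n+m b 3)))))
        (ℕ.≤-reflexive (arithmetic (degree v) b))))
      where
      arithmetic : ∀ l b → 1 ℕ.+ 4 ℕ.* l ℕ.+ (3 ℕ.+ (3 ℕ.+ b)) ≡ 7 ℕ.+ 4 ℕ.* l ℕ.+ b
      arithmetic = solve-∀

    scan-steps : ∀ vs σ d best → steps (scan A εA upper positive s t cut vs σ d best) ℕ.≤
                                 1 ℕ.+ ListAction.sum (map (λ v → 11 ℕ.+ 4 ℕ.* degree v) vs)
    scan-steps []       σ d best = ℕ.≤-refl
    scan-steps (v ∷ vs) σ d best = ℕ.≤-trans (scan-∷-steps v vs σ d best (scan-steps vs (w v + σ)))
      (ℕ.≤-reflexive (ℕ.+-suc (11 ℕ.+ 4 ℕ.* degree v) _))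

  sum-costs : ∀ vs → ListAction.sum (map (λ v → 11 ℕ.+ 4 ℕ.* degree v) vs) ≡
                     11 ℕ.* length vs ℕ.+ 4 ℕ.* ListAction.sum (map degree vs)
  sum-costs []       = refl
  sum-costs (v ∷ vs) rewrite sum-costs vs = arithmetic (degree v) (length vs) (ListAction.sum (map degree vs))
    where
    arithmetic : ∀ a b c → 11 ℕ.+ 4 ℕ.* a ℕ.+ (11 ℕ.* b ℕ.+ 4 ℕ.* c) ≡ 11 ℕ.* ℕ.suc b ℕ.+ 4 ℕ.* (a ℕ.+ c)
    arithmetic = solve-∀

  -- The cost does not depend on the order of the vertices and grows to that of all of them; the
  -- handshake lemma turns four times the degree sum into 8|E|.
  sum-costs-verticesDownFrom : ∀ s → ListAction.sum (map (λ v → 11 ℕ.+ 4 ℕ.* degree v) (verticesDownFrom s)) ℕ.≤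
                                     11 ℕ.* n ℕ.+ 8 ℕ.* ∣E∣
  sum-costs-verticesDownFrom s = begin
    ListAction.sum (map f (reverse (take s (allFin n))))
      ≡⟨ ListAction.sum-↭ (map⁺ f (↭-reverse (take s (allFin n)))) ⟩
    ListAction.sum (map f (take s (allFin n)))            ≤⟨ sum-map-take f s (allFin n) ⟩
    ListAction.sum (map f (allFin n))                     ≡⟨ sum-costs (allFin n) ⟩
    11 ℕ.* length (allFin n) ℕ.+ 4 ℕ.* ListAction.sum (map degree (allFin n))
      ≡⟨ cong₂ (λ a b → 11 ℕ.* a ℕ.+ 4 ℕ.* b) (List.length-tabulate {n = n} (λ v → v)) sum-degree ⟩
    11 ℕ.* n ℕ.+ 4 ℕ.* (∣E∣ ℕ.+ ∣E∣)                      ≡⟨ arithmetic n ∣E∣ ⟩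
    11 ℕ.* n ℕ.+ 8 ℕ.* ∣E∣                                ∎
    where
    open ℕ.≤-Reasoning
    f : Fin n → ℕ
    f v = 11 ℕ.+ 4 ℕ.* degree v
    arithmetic : ∀ a b → 11 ℕ.* a ℕ.+ 4 ℕ.* (b ℕ.+ b) ≡ 11 ℕ.* a ℕ.+ 8 ℕ.* b
    arithmetic = solve-∀

  totalWeight-steps : ∀ {m} (f : Fin m → Fin n) → steps (totalWeight (tabulate f)) ≡ 1 ℕ.+ 2 ℕ.* m
  totalWeight-steps {ℕ.zero}  f = refl
  totalWeight-steps {ℕ.suc m} f rewrite totalWeight-steps (f ∘ Fin.suc) = arithmetic m
    where
    arithmetic : ∀ m → 1 ℕ.+ 2 ℕ.* m ℕ.+ 2 ≡ 1 ℕ.+ 2 ℕ.* ℕ.suc m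
    arithmetic = solve-∀

  allPositive-steps : ∀ {m} (f : Fin m → Fin n) → steps (allPositive (tabulate f)) ≡ 1 ℕ.+ 3 ℕ.* m
  allPositive-steps {ℕ.zero}  f = refl
  allPositive-steps {ℕ.suc m} f rewrite allPositive-steps (f ∘ Fin.suc) = arithmetic m
    where
    arithmetic : ∀ m → 2 ℕ.+ (1 ℕ.+ 3 ℕ.* m ℕ.+ 1) ≡ 1 ℕ.+ 3 ℕ.* ℕ.suc m
    arithmetic = solve-∀

  A′ : Carrier
  A′ = (k · 1#) ⁻¹ * value (totalWeight (allFin n))

  positive′ : Bool
  positive′ = value (allPositive (allFin n))

  entry′ : ℕ → ℕ → Tables → Timed Tables
  entry′ = entry A′ (ε * A′) ((1# + ε) * A′) positive′

  loop : Timed Tables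
  loop = for 1 k (λ t → for t ((n ℕ.+ t) ℕ.∸ k) (entry′ t)) initialTables

  scan′ : ℕ → ℕ → Tables → Timed Best
  scan′ t s T = scan A′ (ε * A′) ((1# + ε) * A′) positive′ s t (cut T) (verticesDownFrom s) 0# 0 nothing

  entry-steps : ∀ {b} t s T → steps (scan′ t s T) ℕ.≤ b → steps (entry′ t s T) ℕ.≤ b ℕ.+ 4
  entry-steps t s T scan≤ = ℕ.+-mono-≤ scan≤ (update-steps A′ (ε * A′) ((1# + ε) * A′) positive′ s t T (value (scan′ t s T)))

  -- Dropping the truncated subtraction of k leaves at most n + 1 rows in each of the k columns;
  -- ticks account for the extra units.
  loop-steps : ∀ e → (∀ t s T → steps (entry′ t s T) ℕ.≤ e) → steps loop ℕ.≤ 1 ℕ.+ k ℕ.* (2 ℕ.+ ℕ.suc n ℕ.* ℕ.suc e)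
  loop-steps e entry≤ = for-steps 1 k _ _ column-steps initialTables
    where
    column-steps : ∀ t T → steps (for t ((n ℕ.+ t) ℕ.∸ k) (entry′ t) T) ℕ.≤ 1 ℕ.+ ℕ.suc n ℕ.* ℕ.suc e
    column-steps t T = ℕ.≤-trans (for-steps t _ (entry′ t) e (entry≤ t) T)
      (ℕ.s≤s (ℕ.*-monoˡ-≤ (ℕ.suc e) (begin
        ℕ.suc ((n ℕ.+ t) ℕ.∸ k) ℕ.∸ t  ≤⟨ ℕ.∸-monoˡ-≤ t (ℕ.s≤s (ℕ.m∸n≤m (n ℕ.+ t) k)) ⟩
        ℕ.suc n ℕ.+ t ℕ.∸ t            ≡⟨ ℕ.m+n∸n≡m (ℕ.suc n) t ⟩
        ℕ.suc n                        ∎)))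
      where open ℕ.≤-Reasoning

  -- The final reversal costs the length of the stored list. A sound entry in column k is empty or
  -- has exactly k blocks.
  parts-length : length (parts (value fillTables) n k) ℕ.≤ k
  parts-length with Optimality.sound-fillTables F G w k ε n k
  ... | inj₁ (parts≡ , _) = ℕ.≤-trans (ℕ.≤-reflexive (cong length parts≡)) ℕ.z≤n
  ... | inj₂ (b , _)      = ℕ.≤-reflexive (Intervals.blocks-length n _ b)

  -- Outside the double loop there are two allocations of (n + 1)(k + 1), two passes over the
  -- weights, a reversal of at most k blocks, and a bounded number of single operations: 2nk + 7n +
  -- 3k + 12 in all. As n, k ≥ 1, this is at most 24nk.
  runningTime-loop : .{{_ : NonZero n}} .{{_ : NonZero k}} → runningTime ℕ.≤ 24 ℕ.* (n ℕ.* k) ℕ.+ steps loop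
  runningTime-loop rewrite totalWeight-steps {n} (λ v → v) | allPositive-steps {n} (λ v → v) = begin
    filling ℕ.+ (2 ℕ.+ length (parts (value fillTables) n k)) ≤⟨ ℕ.+-monoʳ-≤ filling (ℕ.s≤s (ℕ.s≤s parts-length)) ⟩
    filling ℕ.+ (2 ℕ.+ k) ≡⟨ arithmetic n k (steps loop) ⟩
    2 ℕ.* (n ℕ.* k) ℕ.+ 7 ℕ.* n ℕ.+ 3 ℕ.* k ℕ.+ 12 ℕ.* 1 ℕ.+ steps loop
      ≤⟨ ℕ.+-monoˡ-≤ (steps loop) (ℕ.+-mono-≤ (ℕ.+-mono-≤ (ℕ.+-monoʳ-≤ (2 ℕ.* (n ℕ.* k))
           (ℕ.*-monoʳ-≤ 7 (ℕ.m≤m*n n k))) (ℕ.*-monoʳ-≤ 3 (ℕ.m≤n*m k n)))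
           (ℕ.*-monoʳ-≤ 12 (ℕ.>-nonZero⁻¹ (n ℕ.* k) {{ℕ.m*n≢0 n k}}))) ⟩
    2 ℕ.* (n ℕ.* k) ℕ.+ 7 ℕ.* (n ℕ.* k) ℕ.+ 3 ℕ.* (n ℕ.* k) ℕ.+ 12 ℕ.* (n ℕ.* k) ℕ.+ steps loop
      ≡⟨ arithmetic′ (n ℕ.* k) (steps loop) ⟩
    24 ℕ.* (n ℕ.* k) ℕ.+ steps loop ∎
    where
    open ℕ.≤-Reasoning
    filling : ℕ
    filling = 1 ℕ.+ 2 ℕ.* n ℕ.+ (5 ℕ.+ (1 ℕ.+ 3 ℕ.* n ℕ.+
      ((1 ℕ.+ n) ℕ.* (1 ℕ.+ k) ℕ.+ ((1 ℕ.+ n) ℕ.* (1 ℕ.+ k) ℕ.+ (1 ℕ.+ steps loop)))))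
    arithmetic : ∀ n k l →
      1 ℕ.+ 2 ℕ.* n ℕ.+ (5 ℕ.+ (1 ℕ.+ 3 ℕ.* n ℕ.+ ((1 ℕ.+ n) ℕ.* (1 ℕ.+ k) ℕ.+ ((1 ℕ.+ n) ℕ.* (1 ℕ.+ k) ℕ.+ (1 ℕ.+ l))))) ℕ.+ (2 ℕ.+ k) ≡
      2 ℕ.* (n ℕ.* k) ℕ.+ 7 ℕ.* n ℕ.+ 3 ℕ.* k ℕ.+ 12 ℕ.* 1 ℕ.+ l
    arithmetic = solve-∀
    arithmetic′ : ∀ m l → 2 ℕ.* m ℕ.+ 7 ℕ.* m ℕ.+ 3 ℕ.* m ℕ.+ 12 ℕ.* m ℕ.+ l ≡ 24 ℕ.* m ℕ.+ l
    arithmetic′ = solve-∀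

  -- With M = max(n,|E|), an entry and its tick cost at most 6 + 11n + 8|E| ≤ 25M, and n + 1 ≤ 2n.
  -- The total is 77 = 24 + 1 + 2 + 2·25 times nMk.
  runningTime-max : .{{_ : NonZero n}} .{{_ : NonZero k}} → runningTime ℕ.≤ 77 ℕ.* (n ℕ.* (n ℕ.⊔ ∣E∣) ℕ.* k)
  runningTime-max = begin
    runningTime                                           ≤⟨ runningTime-loop ⟩
    24 ℕ.* (n ℕ.* k) ℕ.+ steps loop                       ≤⟨ ℕ.+-monoʳ-≤ (24 ℕ.* (n ℕ.* k)) (loop-steps e entry≤) ⟩
    24 ℕ.* (n ℕ.* k) ℕ.+ (1 ℕ.+ k ℕ.* (2 ℕ.+ (1 ℕ.+ n) ℕ.* (1 ℕ.+ e)))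
      ≤⟨ ℕ.+-mono-≤ (ℕ.*-monoʳ-≤ 24 nk≤) (ℕ.+-mono-≤ 1≤nMk (ℕ.*-monoʳ-≤ k
           (ℕ.+-mono-≤ (ℕ.*-monoʳ-≤ 2 1≤nM) (ℕ.*-mono-≤ (ℕ.+-monoˡ-≤ n 1≤n) 1+e≤)))) ⟩
    24 ℕ.* (n ℕ.* M ℕ.* k) ℕ.+ (n ℕ.* M ℕ.* k ℕ.+ k ℕ.* (2 ℕ.* (n ℕ.* M) ℕ.+ (n ℕ.+ n) ℕ.* (25 ℕ.* M)))
      ≡⟨ arithmetic n M k ⟩
    77 ℕ.* (n ℕ.* M ℕ.* k)                                ∎
    where
    open ℕ.≤-Reasoning
    M = n ℕ.⊔ ∣E∣
    e = 1 ℕ.+ (11 ℕ.* n ℕ.+ 8 ℕ.* ∣E∣) ℕ.+ 4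
    entry≤ : ∀ t s T → steps (entry′ t s T) ℕ.≤ e
    entry≤ t s T = entry-steps t s T (ℕ.≤-trans
      (scan-steps A′ (ε * A′) ((1# + ε) * A′) positive′ s t (cut T) (verticesDownFrom s) 0# 0 nothing)
      (ℕ.s≤s (sum-costs-verticesDownFrom s)))
    1≤n : 1 ℕ.≤ n
    1≤n = ℕ.>-nonZero⁻¹ n
    1≤M : 1 ℕ.≤ M
    1≤M = ℕ.≤-trans 1≤n (ℕ.m≤m⊔n n ∣E∣)
    1≤nM : 1 ℕ.≤ n ℕ.* M
    1≤nM = ℕ.*-mono-≤ 1≤n 1≤M
    1≤nMk : 1 ℕ.≤ n ℕ.* M ℕ.* k
    1≤nMk = ℕ.*-mono-≤ 1≤nM (ℕ.>-nonZero⁻¹ k)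
    nk≤ : n ℕ.* k ℕ.≤ n ℕ.* M ℕ.* k
    nk≤ = ℕ.*-monoˡ-≤ k (ℕ.≤-trans (ℕ.≤-reflexive (≡.sym (ℕ.*-identityʳ n))) (ℕ.*-monoʳ-≤ n 1≤M))
    1+e≤ : 1 ℕ.+ e ℕ.≤ 25 ℕ.* M
    1+e≤ = begin
      1 ℕ.+ e                                    ≡⟨ arithmetic₁ n ∣E∣ ⟩
      6 ℕ.* 1 ℕ.+ 11 ℕ.* n ℕ.+ 8 ℕ.* ∣E∣
        ≤⟨ ℕ.+-mono-≤ (ℕ.+-mono-≤ (ℕ.*-monoʳ-≤ 6 1≤M) (ℕ.*-monoʳ-≤ 11 (ℕ.m≤m⊔n n ∣E∣))) (ℕ.*-monoʳ-≤ 8 (ℕ.m≤n⊔m n ∣E∣)) ⟩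
      6 ℕ.* M ℕ.+ 11 ℕ.* M ℕ.+ 8 ℕ.* M           ≡⟨ arithmetic₂ M ⟩
      25 ℕ.* M                                   ∎
      where
      arithmetic₁ : ∀ n m → 1 ℕ.+ (1 ℕ.+ (11 ℕ.* n ℕ.+ 8 ℕ.* m) ℕ.+ 4) ≡ 6 ℕ.* 1 ℕ.+ 11 ℕ.* n ℕ.+ 8 ℕ.* m
      arithmetic₁ = solve-∀
      arithmetic₂ : ∀ m → 6 ℕ.* m ℕ.+ 11 ℕ.* m ℕ.+ 8 ℕ.* m ≡ 25 ℕ.* m
      arithmetic₂ = solve-∀
    arithmetic : ∀ n m k → 24 ℕ.* (n ℕ.* m ℕ.* k) ℕ.+ (n ℕ.* m ℕ.* k ℕ.+ k ℕ.* (2 ℕ.* (n ℕ.* m) ℕ.+ (n ℕ.+ n) ℕ.* (25 ℕ.* m))) ≡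
                 77 ℕ.* (n ℕ.* m ℕ.* k)
    arithmetic = solve-∀

  module _ (0<w : ∀ v → 0# < w v) {D : ℕ} (degree≤D : ∀ v → degree v ℕ.≤ D)
           {μ : Carrier} (μ≤w : ∀ v → μ ≤ w v) where

    stepCost : ℕ
    stepCost = 11 ℕ.+ 4 ℕ.* D

    -- Every vertex scanned adds at least μ to σ, so if upper < q μ the scan stops within q vertices.
    scan-steps-fuel : ∀ {A εA upper q} → ¬ ι q * μ ≤ upper → ∀ s t cut vs {σ} f {a} → a ℕ.+ f ≡ q → ι a * μ ≤ σ →
                      ∀ d best → steps (scan A εA upper true s t cut vs σ d best) ℕ.≤ 4 ℕ.+ f ℕ.* stepCost
    scan-steps-fuel q≰ s t cut []       f          a+f≡q a≤σ d best = ℕ.s≤s ℕ.z≤n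
    scan-steps-fuel {upper = upper} {q} q≰ s t cut (v ∷ vs) {σ} ℕ.zero    {a} a+f≡q a≤σ d best =
      ℕ.+-monoʳ-≤ 4 (if-elim (λ m → steps m ℕ.≤ 0) (upper <? w v + σ) (λ _ → ℕ.z≤n)
        (λ ≮ → contradiction (≤-trans q≤σ′ (≮⇒≥ ≮)) q≰))
      where
      q≤σ′ : ι q * μ ≤ w v + σ
      q≤σ′ = begin
        ι q * μ  ≡⟨ cong (λ m → ι m * μ) (≡.trans (≡.sym a+f≡q) (ℕ.+-identityʳ a)) ⟩
        ι a * μ  ≤⟨ a≤σ ⟩
        σ        ≈⟨ +-identityˡ σ ⟨
        0# + σ   ≤⟨ +-mono-≤ (proj₁ (0<w v)) ≤-refl ⟩
        w v + σ  ∎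
        where
        open PartialOrderReasoning poset
        open ArchimedeanOrderedField F using (+-identityˡ)
    scan-steps-fuel {A} {εA} {upper} {q} q≰ s t cut (v ∷ vs) {σ} (ℕ.suc f) {a} a+f≡q a≤σ d best = begin
      steps (scan A εA upper true s t cut (v ∷ vs) σ d best)
        ≤⟨ scan-∷-steps A εA upper true s t cut v vs σ d best
             (scan-steps-fuel q≰ s t cut vs f {ℕ.suc a} (≡.trans (≡.sym (ℕ.+-suc a f)) a+f≡q) 1+a≤σ′) ⟩
      11 ℕ.+ 4 ℕ.* degree v ℕ.+ (4 ℕ.+ f ℕ.* stepCost)
        ≤⟨ ℕ.+-monoˡ-≤ _ (ℕ.+-monoʳ-≤ 11 (ℕ.*-monoʳ-≤ 4 (degree≤D v))) ⟩
      stepCost ℕ.+ (4 ℕ.+ f ℕ.* stepCost)                      ≡⟨ arithmetic stepCost (f ℕ.* stepCost) ⟩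
      4 ℕ.+ ℕ.suc f ℕ.* stepCost                               ∎
      where
      open ℕ.≤-Reasoning
      arithmetic : ∀ x y → x ℕ.+ (4 ℕ.+ y) ≡ 4 ℕ.+ (x ℕ.+ y)
      arithmetic = solve-∀
      1+a≤σ′ : ι (ℕ.suc a) * μ ≤ w v + σ
      1+a≤σ′ = ≤-trans (≤-reflexive (ι-suc-* a μ)) (+-mono-≤ (μ≤w v) a≤σ)

    -- The 9 is 4 for the end of a scan, 4 for storing the entry and 1 for the tick of the loop.
    runningTime-fuel : .{{_ : NonZero n}} .{{_ : NonZero k}} → ∀ {q} → ¬ ι q * μ ≤ (1# + ε) * average w k →
                       runningTime ℕ.≤ 24 ℕ.* (n ℕ.* k) ℕ.+ (1 ℕ.+ k ℕ.* (2 ℕ.+ (1 ℕ.+ n) ℕ.* (9 ℕ.+ q ℕ.* stepCost)))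
    runningTime-fuel {q} q≰ = begin
      runningTime                               ≤⟨ runningTime-loop ⟩
      24 ℕ.* (n ℕ.* k) ℕ.+ steps loop
        ≤⟨ ℕ.+-monoʳ-≤ (24 ℕ.* (n ℕ.* k)) (loop-steps (4 ℕ.+ q ℕ.* stepCost ℕ.+ 4) entry≤) ⟩
      24 ℕ.* (n ℕ.* k) ℕ.+ (1 ℕ.+ k ℕ.* (2 ℕ.+ (1 ℕ.+ n) ℕ.* (1 ℕ.+ (4 ℕ.+ q ℕ.* stepCost ℕ.+ 4))))
        ≡⟨ cong (λ e → 24 ℕ.* (n ℕ.* k) ℕ.+ (1 ℕ.+ k ℕ.* (2 ℕ.+ (1 ℕ.+ n) ℕ.* (1 ℕ.+ e)))) (ℕ.+-comm (4 ℕ.+ q ℕ.* stepCost) 4) ⟩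
      24 ℕ.* (n ℕ.* k) ℕ.+ (1 ℕ.+ k ℕ.* (2 ℕ.+ (1 ℕ.+ n) ℕ.* (9 ℕ.+ q ℕ.* stepCost))) ∎
      where
      open ℕ.≤-Reasoning
      q≰′ : ¬ ι q * μ ≤ (1# + ε) * A′
      q≰′ = subst (λ W → ¬ ι q * μ ≤ (1# + ε) * ((k · 1#) ⁻¹ * W)) (≡.sym (totalWeight-value (λ v → v))) q≰
      scan≤ : ∀ t s T → steps (scan′ t s T) ℕ.≤ 4 ℕ.+ q ℕ.* stepCost
      scan≤ t s T = subst (λ b → steps (scan A′ (ε * A′) ((1# + ε) * A′) b s t (cut T) (verticesDownFrom s) 0# 0 nothing) ℕ.≤
                              4 ℕ.+ q ℕ.* stepCost)
        (≡.sym (allPositive-value⁺ (λ v → v) 0<w))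
        (scan-steps-fuel q≰′ s t (cut T) (verticesDownFrom s) q {0} refl
          (≤-reflexive (ArchimedeanOrderedField.zeroˡ F μ)) 0 nothing)
      entry≤ : ∀ t s T → steps (entry′ t s T) ℕ.≤ 4 ℕ.+ q ℕ.* stepCost ℕ.+ 4
      entry≤ t s T = entry-steps t s T (scan≤ t s T)

-- The quadratic bound

module _ {c ℓ₁ ℓ₂} (F : ArchimedeanOrderedField c ℓ₁ ℓ₂) where
  open ArchimedeanOrderedField F renaming (refl to ≈-refl; sym to ≈-sym; trans to ≈-trans)
  open OrderedFieldProperties F
  open Weights F
  open Extrema totalOrder using (min≤xs; xs≤max; argmin-all)

  minWeight-≤ : ∀ {n} .{{_ : NonZero n}} (w : Vector Carrier n) v → minWeight w ≤ w v
  minWeight-≤ {ℕ.suc n} w = All.tabulate⁻ (min≤xs (w Fin.zero) (tabulate w))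

  ≤-maxWeight : ∀ {n} .{{_ : NonZero n}} (w : Vector Carrier n) v → w v ≤ maxWeight w
  ≤-maxWeight {ℕ.suc n} w = All.tabulate⁻ (xs≤max (w Fin.zero) (tabulate w))

  0<minWeight : ∀ {n} .{{_ : NonZero n}} (w : Vector Carrier n) → (∀ v → 0# < w v) → 0# < minWeight w
  0<minWeight {ℕ.suc n} w 0<w = argmin-all (λ x → x) {P = 0# <_} (0<w Fin.zero) (All.tabulate⁺ 0<w)

  module _ {ε C : Carrier} (0<ε : 0# < ε) {n : ℕ} .{{_ : NonZero n}} (w : Vector Carrier n) (k : ℕ) .{{_ : NonZero k}}
           (0<w : ∀ v → 0# < w v) (ratio : maxWeight w * minWeight w ⁻¹ ≤ C)
           {M : ℕ} (bound : (1# + ε) * C ≤ ι M) where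

    private
      μ = minWeight w

    -- If qμ were at most (1 + ε)A, multiplying by k would give kqμ ≤ (1 + ε)nCμ ≤ Mnμ, since every
    -- weight is at most Cμ. Cancelling μ > 0 contradicts Mn < kq.
    upper-bound : ∀ {q} → M ℕ.* n ℕ.< k ℕ.* q → ¬ ι q * μ ≤ (1# + ε) * average w k
    upper-bound {q} Mn<kq q≤ = ℕ.<⇒≱ Mn<kq (ι-*-cancelʳ-≤ {m = k ℕ.* q} {M ℕ.* n} 0<μ (begin
      ι (k ℕ.* q) * μ                        ≈⟨ *-congʳ (ι-homo-* k q) ⟩
      ι k * ι q * μ                          ≈⟨ *-assoc _ _ _ ⟩
      ι k * (ι q * μ)                        ≤⟨ *-monoˡ-≤ (0≤ι k) q≤ ⟩
      ι k * ((1# + ε) * average w k)         ≈⟨ ι*[x*[ι⁻¹*y]]≈x*y k (1# + ε) (sum w) ⟩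
      (1# + ε) * sum w                       ≤⟨ *-monoˡ-≤ (0≤1+x 0<ε) (sum-≤ w w≤) ⟩
      (1# + ε) * (ι n * (C * μ))             ≈⟨ *-congˡ (*-assoc _ _ _) ⟨
      (1# + ε) * (ι n * C * μ)               ≈⟨ *-congˡ (*-congʳ (*-comm _ _)) ⟩
      (1# + ε) * (C * ι n * μ)               ≈⟨ *-congˡ (*-assoc _ _ _) ⟩
      (1# + ε) * (C * (ι n * μ))             ≈⟨ *-assoc _ _ _ ⟨
      (1# + ε) * C * (ι n * μ)               ≤⟨ *-monoʳ-≤ (*-nonneg (0≤ι n) (proj₁ 0<μ)) bound ⟩
      ι M * (ι n * μ)                        ≈⟨ *-assoc _ _ _ ⟨
      ι M * ι n * μ                          ≈⟨ *-congʳ (ι-homo-* M n) ⟨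
      ι (M ℕ.* n) * μ                        ∎))
      where
      open PartialOrderReasoning poset
      0<μ : 0# < μ
      0<μ = 0<minWeight w 0<w
      w≤ : ∀ v → w v ≤ C * μ
      w≤ v = ≤-trans (≤-maxWeight w v) (x*y⁻¹≤z⇒x≤z*y 0<μ ratio)

    runningTime-square : (G : Graph n) {D : ℕ} → k ℕ.≤ n → (∀ v → Graph.degree G v ℕ.≤ D) →
                         DynamicPartition.runningTime F G w k ε ℕ.≤
                         (45 ℕ.+ 2 ℕ.* ((1 ℕ.+ M) ℕ.* (11 ℕ.+ 4 ℕ.* D))) ℕ.* n ℕ.^ 2
    runningTime-square G {D} k≤n degree≤D = begin
      DynamicPartition.runningTime F G w k ε
        ≤⟨ RunningTime.runningTime-fuel F G w k ε 0<w degree≤D (minWeight-≤ w) {limit} (upper-bound {limit} Mn<k*limit) ⟩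
      24 ℕ.* (n ℕ.* k) ℕ.+ (1 ℕ.+ k ℕ.* (2 ℕ.+ (1 ℕ.+ n) ℕ.* (9 ℕ.+ limit ℕ.* d)))
        ≤⟨ ℕ.+-mono-≤ (ℕ.*-monoʳ-≤ 24 (ℕ.*-monoʳ-≤ n k≤n)) (ℕ.+-mono-≤ (ℕ.*-mono-≤ 1≤n 1≤n)
             (ℕ.*-monoʳ-≤ k (ℕ.+-monoʳ-≤ 2 (ℕ.*-monoˡ-≤ (9 ℕ.+ limit ℕ.* d) (ℕ.+-monoˡ-≤ n 1≤n))))) ⟩
      24 ℕ.* (n ℕ.* n) ℕ.+ (n ℕ.* n ℕ.+ k ℕ.* (2 ℕ.+ (n ℕ.+ n) ℕ.* (9 ℕ.+ limit ℕ.* d)))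
        ≡⟨ arithmetic₁ n k limit d ⟩
      25 ℕ.* (n ℕ.* n) ℕ.+ (2 ℕ.* (k ℕ.* 1) ℕ.+ 2 ℕ.* n ℕ.* (9 ℕ.* k ℕ.+ k ℕ.* limit ℕ.* d))
        ≤⟨ ℕ.+-monoʳ-≤ (25 ℕ.* (n ℕ.* n)) (ℕ.+-mono-≤ (ℕ.*-monoʳ-≤ 2 (ℕ.*-mono-≤ k≤n 1≤n))
             (ℕ.*-monoʳ-≤ (2 ℕ.* n) (ℕ.+-mono-≤ (ℕ.*-monoʳ-≤ 9 k≤n) (ℕ.*-monoˡ-≤ d k*limit≤)))) ⟩
      25 ℕ.* (n ℕ.* n) ℕ.+ (2 ℕ.* (n ℕ.* n) ℕ.+ 2 ℕ.* n ℕ.* (9 ℕ.* n ℕ.+ (n ℕ.+ M ℕ.* n) ℕ.* d))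
        ≡⟨ arithmetic₂ n M d ⟩
      (45 ℕ.+ 2 ℕ.* ((1 ℕ.+ M) ℕ.* d)) ℕ.* n ℕ.^ 2 ∎
      where
      open ℕ.≤-Reasoning
      d = 11 ℕ.+ 4 ℕ.* D
      -- The least q with Mn < kq. Rounding up adds at most k ≤ n to the product kq, so it stays
      -- within (1 + M)n.
      limit = ℕ.suc (M ℕ.* n ℕ./ k)
      1≤n : 1 ℕ.≤ n
      1≤n = ℕ.>-nonZero⁻¹ n
      Mn<k*limit : M ℕ.* n ℕ.< k ℕ.* limit
      Mn<k*limit = begin-strict
        M ℕ.* n                                          ≡⟨ ℕ.m≡m%n+[m/n]*n (M ℕ.* n) k ⟩
        M ℕ.* n ℕ.% k ℕ.+ M ℕ.* n ℕ./ k ℕ.* k            <⟨ ℕ.+-monoˡ-< _ (ℕ.m%n<n (M ℕ.* n) k) ⟩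
        limit ℕ.* k                                          ≡⟨ ℕ.*-comm limit k ⟩
        k ℕ.* limit                                          ∎
      k*limit≤ : k ℕ.* limit ℕ.≤ n ℕ.+ M ℕ.* n
      k*limit≤ = ℕ.≤-trans (ℕ.≤-reflexive (ℕ.*-comm k limit)) (ℕ.+-mono-≤ k≤n (ℕ.m/n*n≤m (M ℕ.* n) k))
      arithmetic₁ : ∀ n k q d → 24 ℕ.* (n ℕ.* n) ℕ.+ (n ℕ.* n ℕ.+ k ℕ.* (2 ℕ.+ (n ℕ.+ n) ℕ.* (9 ℕ.+ q ℕ.* d))) ≡
                    25 ℕ.* (n ℕ.* n) ℕ.+ (2 ℕ.* (k ℕ.* 1) ℕ.+ 2 ℕ.* n ℕ.* (9 ℕ.* k ℕ.+ k ℕ.* q ℕ.* d))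
      arithmetic₁ = solve-∀
      arithmetic₂ : ∀ n m d → 25 ℕ.* (n ℕ.* n) ℕ.+ (2 ℕ.* (n ℕ.* n) ℕ.+ 2 ℕ.* n ℕ.* (9 ℕ.* n ℕ.+ (n ℕ.+ m ℕ.* n) ℕ.* d)) ≡
                    (45 ℕ.+ 2 ℕ.* ((1 ℕ.+ m) ℕ.* d)) ℕ.* (n ℕ.* (n ℕ.* 1))
      arithmetic₂ = solve-∀

theorem3 :
  ∀ {c ℓ₁ ℓ₂} (F : ArchimedeanOrderedField c ℓ₁ ℓ₂) →
  let open ArchimedeanOrderedField F
      open Graph
      open Weights F
      open DynamicPartition F
  in
  -- O(|V||E|k), for graphs with |V| = O(|E|)
  (∀ (b : ℕ) → ∃[ K ]
    ∀ (n : ℕ) .{{_ : NonZero n}} (G : Graph n) (w : Vector Carrier n)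
      (k : ℕ) .{{_ : NonZero k}} (ε : Carrier) → 0# < ε →
    n ℕ.≤ b ℕ.* ∣E∣ G →
    runningTime G w k ε ℕ.≤ K ℕ.* (n ℕ.* ∣E∣ G ℕ.* k))
  ×
  -- the same for all graphs, with max{|V|,|E|} in place of |E|
  (∃[ K ]
    ∀ (n : ℕ) .{{_ : NonZero n}} (G : Graph n) (w : Vector Carrier n)
      (k : ℕ) .{{_ : NonZero k}} (ε : Carrier) → 0# < ε →
    runningTime G w k ε ℕ.≤ K ℕ.* (n ℕ.* (n ℕ.⊔ ∣E∣ G) ℕ.* k))
  ×
  -- O(|V|²)
  (∀ (ε : Carrier) → 0# < ε → ∀ (D : ℕ) (C : Carrier) → ∃[ K ]
    ∀ (n : ℕ) .{{_ : NonZero n}} (G : Graph n) (w : Vector Carrier n)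
      (k : ℕ) .{{_ : NonZero k}} → k ℕ.≤ n →
    (∀ v → 0# < w v) →
    (∀ v → degree G v ℕ.≤ D) →
    maxWeight w * minWeight w ⁻¹ ≤ C →
    runningTime G w k ε ℕ.≤ K ℕ.* n ℕ.^ 2)
  ×
  (∀ (n : ℕ) (G : Graph n) (w : Vector Carrier n)
     (k : ℕ) .{{_ : NonZero k}} (ε : Carrier) → 0# < ε →
   -- the program carries out the algorithm as described
   SatisfiesRecurrence G w k ε (value (fillTables G w k ε))
   ×
   ((∃[ P ] IsBalancedConsistentPartition w k ε P) →
     IsBalancedConsistentPartition w k ε (output G w k ε)
     ×
     (∀ P → IsBalancedConsistentPartition w k ε P →
       cutEdges (edges G) (output G w k ε) ℕ.≤ cutEdges (edges G) P)
     ×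
     (OrderingIsHamiltonianPath G →
       ∀ i → Connected G (lookup (output G w k ε) i))))
theorem3 F =
  -- From n ≤ b|E| follows max(n,|E|) ≤ (b + 1)|E|, whence the factor b + 1.
  (λ b → 77 ℕ.* ℕ.suc b , λ n G w k ε _ n≤b∣E∣ → let m = Graph.∣E∣ G in begin
    DynamicPartition.runningTime F G w k ε      ≤⟨ RunningTime.runningTime-max F G w k ε ⟩
    77 ℕ.* (n ℕ.* (n ℕ.⊔ m) ℕ.* k)              ≤⟨ ℕ.*-monoʳ-≤ 77 (ℕ.*-monoˡ-≤ k (ℕ.*-monoʳ-≤ n
                                                     (ℕ.⊔-lub (ℕ.≤-trans n≤b∣E∣ (ℕ.m≤n+m (b ℕ.* m) m)) (ℕ.m≤m+n m (b ℕ.* m))))) ⟩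
    77 ℕ.* (n ℕ.* (ℕ.suc b ℕ.* m) ℕ.* k)        ≡⟨ rearrange n b m k ⟩
    77 ℕ.* ℕ.suc b ℕ.* (n ℕ.* m ℕ.* k)          ∎) ,
  (77 , λ n G w k ε _ → RunningTime.runningTime-max F G w k ε) ,
  -- The Archimedean property provides M from ε and C alone, so the constant is fixed before the
  -- graph, the weights and k.
  (λ ε 0<ε D C → let M , bound = archimedean ((1# + ε) * C) in
    45 ℕ.+ 2 ℕ.* ((1 ℕ.+ M) ℕ.* (11 ℕ.+ 4 ℕ.* D)) , λ n G w k k≤n 0<w degree≤D ratio →
      runningTime-square F 0<ε w k 0<w ratio {M} bound G k≤n degree≤D) ,
  λ n G w k ε _ → Recurrence.satisfiesRecurrence F G w k ε ,
    λ exists → let open Optimality F G w k ε in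
      output-balanced exists , output-minimal exists , output-connected exists
  where
  open ArchimedeanOrderedField F using (archimedean; 1#; _+_; _*_)
  open ℕ.≤-Reasoning
  rearrange : ∀ n b m k → 77 ℕ.* (n ℕ.* ((1 ℕ.+ b) ℕ.* m) ℕ.* k) ≡ 77 ℕ.* (1 ℕ.+ b) ℕ.* (n ℕ.* m ℕ.* k)
  rearrange = solve-∀
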